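{- There exists a randomized algorithm in the adversarial comparator model (against an adaptive adversary) that, on input $n$ items, makes $O(n\log^2 n)$ comparisons, uses $O(\log n)$ parallel rounds, and returns a $4$-approximate sorting of the items with probability $>1-\frac{1}{n^2}$.
   Context: Adversarial comparator model: we are given $n$ items $x_1,\dots,x_n$ with unknown real values. The algorithm can only access the items through a comparator $C$ which, given two items $x_i,x_j$, returns $\max\{x_i,x_j\}$ if $|x_i-x_j|>1$, and otherwise returns either $x_i$ or $x_j$ as chosen by an adversary. The adversary is adaptive: its choices may depend on all previous queries and answers. In the parallel (round) model, in each round the algorithm submits a set of comparisons, chosen based on the answers of previous rounds, and receives all their answers. For reals $a,b$ write $a\ge_k b$ if $a\ge b-k$. An ordering $y_1,\dots,y_n$ of the items is a $k$-approximate sorting if $y_j\ge_k y_i$ for all $j>i$.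
   Formalization: The unknown values of the items are taken to be rational numbers instead of real numbers. -}

module Defs where

open import Data.Bool using (Bool; true; false; if_then_else_)
open import Data.Nat as ℕ using (ℕ; zero; suc; _+_; _*_; _∸_; _^_)
open import Data.Fin as Fin using (Fin)
open import Data.Fin.Permutation using (Permutation′; _⟨$⟩ʳ_)
open import Data.Fin.Properties as FinP using (all?)
open import Relation.Nullary.Decidable using (_→-dec_)
open import Data.Integer using (+_)
open import Data.Rational as ℚ using (ℚ; _/_; ∣_∣; _-_; 1ℚ)
open import Data.Rational.Properties as ℚP using ()
open import Data.List as List using (List; []; _∷_; _++_; length; lookup; tabulate; filter)
open import Data.Nat.ListAction using (sum)
open import Data.Vec as Vec using (Vec)
open import Data.Product using (_×_; _,_)
open import Relation.Nullary using (Dec; yes; no)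
open import Relation.Nullary.Decidable using (does)

-- Items are indices Fin n; their hidden values are x : Fin n → ℚ.

Query : ℕ → Set
Query n = Fin n × Fin n

-- One round of the history: each submitted query together with the
-- answer (the item returned by the comparator).
Round : ℕ → Set
Round n = List (Query n × Fin n)

-- Full history: the rounds so far, in chronological order.
History : ℕ → Set
History n = List (Round n)

Bits : ℕ → Set
Bits m = Vec Bool m

-- A randomized parallel algorithm for n items: it uses `rbits` uniformly
-- random bits (drawn up front, hidden from the adversary), runs for
-- `rounds` rounds; in each round it submits a list of comparisons chosen
-- from its random bits and the history of previous rounds, and finally
-- outputs an ordering  y_k = x (out ⟨$⟩ʳ k).
record Algorithm (n : ℕ) : Set where
  field
    rbits   : ℕ
    rounds  : ℕ
    queries : Bits rbits → History n → List (Query n)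
    output  : Bits rbits → History n → Permutation′ n

-- An adaptive adversary: given the history of previous rounds and the
-- queries of the current round, it chooses for each query (by position)
-- which of the two items to return (true = first, false = second).  The
-- choice is only used when the two values are within distance 1.
Adversary : ℕ → Set
Adversary n = History n → (qs : List (Query n)) → Fin (length qs) → Bool

comparator : ∀ {n} → (Fin n → ℚ) → Fin n → Fin n → Bool → Fin n
comparator x i j b with 1ℚ ℚP.<? ∣ x i - x j ∣
... | yes _ = if does (x j ℚP.<? x i) then i else j
... | no  _ = if b then i else j

answerRound : ∀ {n} → (Fin n → ℚ) → Adversary n → History n → List (Query n) → Round n
answerRound x adv h qs =
  tabulate (λ (k : Fin (length qs)) →
    let q = lookup qs k in
    (q , comparator x (Data.Product.proj₁ q) (Data.Product.proj₂ q) (adv h qs k)))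
  where import Data.Product

runFrom : ∀ {n} (A : Algorithm n) → (Fin n → ℚ) → Adversary n →
          Bits (Algorithm.rbits A) → ℕ → History n → History n
runFrom A x adv ρ zero    h = h
runFrom A x adv ρ (suc r) h =
  runFrom A x adv ρ r (h ++ (answerRound x adv h (Algorithm.queries A ρ h) ∷ []))

finalHistory : ∀ {n} (A : Algorithm n) → (Fin n → ℚ) → Adversary n →
               Bits (Algorithm.rbits A) → History n
finalHistory A x adv ρ = runFrom A x adv ρ (Algorithm.rounds A) []

numComparisons : ∀ {n} → History n → ℕ
numComparisons h = sum (List.map length h)

numRounds : ∀ {n} → History n → ℕ
numRounds h = length (filter (λ r → ℕ._≤?_ 1 (length r)) h)

result : ∀ {n} (A : Algorithm n) → (Fin n → ℚ) → Adversary n →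
         Bits (Algorithm.rbits A) → Permutation′ n
result A x adv ρ = Algorithm.output A ρ (finalHistory A x adv ρ)

_≥[_]_ : ℚ → ℚ → ℚ → Set
a ≥[ k ] b = b - k ℚ.≤ a

IsApproxSorting : ∀ {n} → ℚ → (Fin n → ℚ) → Permutation′ n → Set
IsApproxSorting {n} k x y =
  ∀ (i j : Fin n) → i Fin.< j → x (y ⟨$⟩ʳ j) ≥[ k ] x (y ⟨$⟩ʳ i)

isApproxSorting? : ∀ {n} (k : ℚ) (x : Fin n → ℚ) (y : Permutation′ n) →
                   Dec (IsApproxSorting k x y)
isApproxSorting? k x y =
  all? (λ i → all? (λ j →
    (i FinP.<? j) →-dec (x (y ⟨$⟩ʳ i) ℚ.- k ℚP.≤? x (y ⟨$⟩ʳ j))))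

-- Uniform probability over random bit strings, by counting.

allBits : (m : ℕ) → List (Bits m)
allBits zero    = Vec.[] ∷ []
allBits (suc m) = List.map (true Vec.∷_) (allBits m) ++ List.map (false Vec.∷_) (allBits m)

countGood : ∀ {m} {P : Bits m → Set} → ((ρ : Bits m) → Dec (P ρ)) → ℕ
countGood {m} P? = length (filter P? (allBits m))

{-# OPTIONS --safe #-}
module Submission where

-- The sorter keeps an ordered list of groups of items and refines every group once per round.  The
-- items of a group of size m get random colours, M of them, with m/M of order log n; each item is
-- compared with the items of its own colour class and with one fixed class, the pivots.
--
-- Let s(z) be the number of pivots that z beats.  If x u > x z + 2 then u beats every pivot that z
-- beats, so cutting the group by s errs by at most 2.  Let now s(z) = s(w) = s and x z > x w + 4.
-- Every pivot that w beats is at most x w + 1, so, the classes being balanced up to δ, at least s - δ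
-- items of the class of z are at most x w + 1.  When that class is sorted by the number of wins within
-- it, which errs by at most 2, all these items precede z.  Hence the items of score s that are among
-- the first s - δ of their class can be placed, in any order, before all others of score s, and dually
-- those behind position s + δ after all others.  Both kinds become singletons; what remains between
-- them has at most 2δM ≤ m/2 items, so about log n rounds suffice.
--
-- Balance means that each of the sets {y : x y ≤ x w + 1} and {y : x y + 1 < x w} meets any two classes
-- in numbers differing by at most δ.  The adversary fixes the groups before the colours of a round are
-- drawn, so this follows from Chernoff's bound and a union bound over these sets, pairs of colours and
-- rounds.

open import Defs
open import Algebra.Properties.Group using (⁻¹-anti-homo-//)
open import Data.Bool using (Bool; true; false; if_then_else_; not; T; _∧_; _∨_)
open import Data.Bool.ListAction using (any)
open import Data.Bool.Properties as Bool using (T-∨)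
open import Data.Empty using (⊥; ⊥-elim)
open import Data.Fin as Fin using (Fin; zero; suc)
open import Data.Fin.Permutation using (Permutation; Permutation′; _⟨$⟩ʳ_; cast-id; _∘ₚ_)
open import Data.Fin.Properties as Fin using ()
open import Data.Integer as ℤ using ()
open import Data.List as List
  using (List; []; _∷_; [_]; _++_; length; map; concat; concatMap; filterᵇ; allFin; take; drop; upTo)
open import Data.List.Membership.Propositional using (_∈_)
open import Data.List.Membership.Propositional.Properties
import Data.List.Membership.DecPropositional as DecMembership
open import Data.List.Properties
  using (map-tabulate; length-++; length-map; length-filter; length-take; length-tabulate; lookup-tabulate;
         take++drop≡id; concat-++; concat-map-[_]; filter-++; ++-assoc; ++-identityʳ; map-id)
open import Data.List.Relation.Binary.Permutation.Propositional as ↭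
  using (_↭_; ↭-sym; ↭-trans; ↭-reflexive; ↭-refl; ↭⇒↭ₛ)
open import Data.List.Relation.Binary.Permutation.Propositional.Properties as ↭ using (filter-↭; ∈-resp-↭; ↭-length)
import Data.List.Relation.Binary.Permutation.Homogeneous as Homogeneous
import Data.List.Relation.Binary.Permutation.Setoid.Properties as Permutationₛ
open import Data.List.Relation.Unary.All as All using (All; []; _∷_)
open import Data.List.Relation.Unary.All.Properties as All using ()
open import Data.List.Relation.Unary.AllPairs as AllPairs using (AllPairs; []; _∷_)
open import Data.List.Relation.Unary.AllPairs.Properties as AllPairs using ()
open import Data.List.Relation.Unary.Any as Any using (here; there)
open import Data.List.Relation.Unary.Any.Properties using (lookup-index)
open import Data.List.Relation.Unary.Linked.Properties using (Linked⇒AllPairs)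
open import Data.List.Relation.Unary.Unique.Propositional using (Unique)
open import Data.List.Relation.Unary.Unique.Propositional.Properties as Unique using ()
import Data.List.Sort as Sort
open import Data.Nat hiding (_/_)
open import Data.Nat.ListAction using (sum)
open import Data.Nat.Logarithm using (⌊log₂_⌋; ⌊log₂⌋-mono-≤; ⌊log₂[2^n]⌋≡n)
open import Data.Nat.Properties
open import Data.Nat.Tactic.RingSolver using (solve-∀)
open import Data.Product using (_×_; _,_; proj₁; proj₂; ∃; Σ)
open import Data.Product.Properties as Product using ()
open import Data.Rational as ℚ using (ℚ; 1ℚ)
open import Data.Rational.Properties as ℚ using ()
open import Data.Sum using (_⊎_; inj₁; inj₂)
open import Data.Vec as Vec using (Vec; []; _∷_)
open import Data.Vec.Properties using (≡-dec; ∷-injectiveʳ)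
open import Function using (_∘_; Equivalence)
open import Relation.Binary.Definitions using (DecidableEquality)
import Relation.Binary.Construct.On as On
open import Relation.Binary.PropositionalEquality hiding ([_])
open import Relation.Nullary using (Dec; yes; no; ¬_)
open import Relation.Nullary.Decidable using (does; T?)

-- Finite sums and bit strings

⟦_⟧ : Bool → ℕ
⟦ true ⟧  = 1
⟦ false ⟧ = 0

module _ {A : Set} where

  ∑ : List A → (A → ℕ) → ℕ
  ∑ xs f = sum (map f xs)

  count : (A → Bool) → List A → ℕ
  count p xs = ∑ xs (⟦_⟧ ∘ p)

  ∑-mono-∈ : ∀ xs {f g : A → ℕ} → (∀ {x} → x ∈ xs → f x ≤ g x) → ∑ xs f ≤ ∑ xs g
  ∑-mono-∈ []       h = z≤n
  ∑-mono-∈ (x ∷ xs) h = +-mono-≤ (h (here refl)) (∑-mono-∈ xs (h ∘ there))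

  ∑-mono : ∀ xs {f g : A → ℕ} → (∀ x → f x ≤ g x) → ∑ xs f ≤ ∑ xs g
  ∑-mono xs h = ∑-mono-∈ xs (λ {x} _ → h x)

  ∑-cong-∈ : ∀ xs {f g : A → ℕ} → (∀ {x} → x ∈ xs → f x ≡ g x) → ∑ xs f ≡ ∑ xs g
  ∑-cong-∈ []       h = refl
  ∑-cong-∈ (x ∷ xs) h = cong₂ _+_ (h (here refl)) (∑-cong-∈ xs (h ∘ there))

  ∑-cong : ∀ xs {f g : A → ℕ} → (∀ x → f x ≡ g x) → ∑ xs f ≡ ∑ xs g
  ∑-cong xs h = ∑-cong-∈ xs (λ {x} _ → h x)

  ∑-++ : ∀ xs ys (f : A → ℕ) → ∑ (xs List.++ ys) f ≡ ∑ xs f + ∑ ys f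
  ∑-++ []       ys f = refl
  ∑-++ (x ∷ xs) ys f = trans (cong (f x +_) (∑-++ xs ys f)) (sym (+-assoc (f x) _ _))

  ∑-+ : ∀ xs (f g : A → ℕ) → ∑ xs (λ x → f x + g x) ≡ ∑ xs f + ∑ xs g
  ∑-+ []       f g = refl
  ∑-+ (x ∷ xs) f g rewrite ∑-+ xs f g = lem (f x) (g x) (∑ xs f) (∑ xs g)
    where
    lem : ∀ a b c d → a + b + (c + d) ≡ a + c + (b + d)
    lem = solve-∀

  ∑-*ʳ : ∀ xs (f : A → ℕ) c → ∑ xs (λ x → f x * c) ≡ ∑ xs f * c
  ∑-*ʳ []       f c = refl
  ∑-*ʳ (x ∷ xs) f c rewrite ∑-*ʳ xs f c = sym (*-distribʳ-+ c (f x) (∑ xs f))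

  ∑-*ˡ : ∀ xs (f : A → ℕ) c → ∑ xs (λ x → c * f x) ≡ c * ∑ xs f
  ∑-*ˡ []       f c = sym (*-zeroʳ c)
  ∑-*ˡ (x ∷ xs) f c rewrite ∑-*ˡ xs f c = sym (*-distribˡ-+ c (f x) (∑ xs f))

  ∑-const : ∀ (xs : List A) c → ∑ xs (λ _ → c) ≡ length xs * c
  ∑-const []       c = refl
  ∑-const (x ∷ xs) c = cong (c +_) (∑-const xs c)

  ∑-∈ : ∀ {xs x} (f : A → ℕ) → x ∈ xs → f x ≤ ∑ xs f
  ∑-∈ f (here refl) = m≤m+n _ _
  ∑-∈ f (there x∈)  = ≤-trans (∑-∈ f x∈) (m≤n+m _ _)

  ∑-↭ : ∀ {xs ys} (f : A → ℕ) → xs ↭ ys → ∑ xs f ≡ ∑ ys f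
  ∑-↭ f ↭.refl          = refl
  ∑-↭ f (↭.prep x p)    = cong (f x +_) (∑-↭ f p)
  ∑-↭ f (↭.swap {xs} {ys} x y p) rewrite ∑-↭ f p = lem (f x) (f y) (∑ ys f)
    where
    lem : ∀ a b c → a + (b + c) ≡ b + (a + c)
    lem = solve-∀
  ∑-↭ f (↭.trans p q)   = trans (∑-↭ f p) (∑-↭ f q)

  count-filterᵇ : ∀ p q xs → count p (filterᵇ q xs) ≡ count (λ x → q x ∧ p x) xs
  count-filterᵇ p q []       = refl
  count-filterᵇ p q (x ∷ xs) with q x
  ... | true  = cong (⟦ p x ⟧ +_) (count-filterᵇ p q xs)
  ... | false = count-filterᵇ p q xs

  length-filterᵇ : ∀ p xs → length (filterᵇ p xs) ≡ count p xs
  length-filterᵇ p []       = refl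
  length-filterᵇ p (x ∷ xs) with p x
  ... | true  = cong suc (length-filterᵇ p xs)
  ... | false = length-filterᵇ p xs

∑-map : ∀ {A B : Set} (g : A → B) xs (f : B → ℕ) → ∑ (map g xs) f ≡ ∑ xs (f ∘ g)
∑-map g []       f = refl
∑-map g (x ∷ xs) f = cong (f (g x) +_) (∑-map g xs f)

∑-swap : ∀ {A B : Set} xs ys (f : A → B → ℕ) →
         ∑ xs (λ x → ∑ ys (f x)) ≡ ∑ ys (λ y → ∑ xs (λ x → f x y))
∑-swap []       ys f = sym (trans (∑-const ys 0) (*-zeroʳ (length ys)))
∑-swap (x ∷ xs) ys f = trans (cong (∑ ys (f x) +_) (∑-swap xs ys f))
                             (sym (∑-+ ys (f x) (λ y → ∑ xs (λ x → f x y))))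

length-allBits : ∀ m → length (allBits m) ≡ 2 ^ m
length-allBits zero    = refl
length-allBits (suc m) = begin
  length (map (true ∷_) (allBits m) List.++ map (false ∷_) (allBits m))
    ≡⟨ length-++ (map (true ∷_) (allBits m)) ⟩
  length (map (true Vec.∷_) (allBits m)) + length (map (false Vec.∷_) (allBits m))
    ≡⟨ cong₂ _+_ (length-map _ (allBits m)) (length-map _ (allBits m)) ⟩
  length (allBits m) + length (allBits m)
    ≡⟨ cong (λ k → k + k) (length-allBits m) ⟩
  2 ^ m + 2 ^ m
    ≡⟨ cong (2 ^ m +_) (+-identityʳ (2 ^ m)) ⟨
  2 * 2 ^ m ∎
  where open ≡-Reasoning

∈-allBits : ∀ {m} (v : Bits m) → v ∈ allBits m
∈-allBits []          = here refl
∈-allBits (true  ∷ v) = ∈-++⁺ˡ (∈-map⁺ (true Vec.∷_) (∈-allBits v))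
∈-allBits (false ∷ v) = ∈-++⁺ʳ (map (true Vec.∷_) (allBits _)) (∈-map⁺ (false Vec.∷_) (∈-allBits v))

∑-allBits-suc : ∀ m (f : Bits (suc m) → ℕ) →
  ∑ (allBits (suc m)) f ≡ ∑ (allBits m) (f ∘ (true ∷_)) + ∑ (allBits m) (f ∘ (false ∷_))
∑-allBits-suc m f = trans (∑-++ (map (true ∷_) (allBits m)) _ f)
  (cong₂ _+_ (∑-map (true ∷_) (allBits m) f) (∑-map (false ∷_) (allBits m) f))

∑-allBits-+ : ∀ m n (f : Bits (m + n) → ℕ) →
  ∑ (allBits (m + n)) f ≡ ∑ (allBits m) (λ a → ∑ (allBits n) (λ b → f (a Vec.++ b)))
∑-allBits-+ zero    n f = sym (+-identityʳ _)
∑-allBits-+ (suc m) n f = begin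
  ∑ (allBits (suc m + n)) f
    ≡⟨ ∑-allBits-suc (m + n) f ⟩
  ∑ (allBits (m + n)) (f ∘ (true ∷_)) + ∑ (allBits (m + n)) (f ∘ (false ∷_))
    ≡⟨ cong₂ _+_ (∑-allBits-+ m n (f ∘ (true ∷_))) (∑-allBits-+ m n (f ∘ (false ∷_))) ⟩
  _ ≡⟨ ∑-allBits-suc m (λ a → ∑ (allBits n) (λ b → f (a Vec.++ b))) ⟨
  ∑ (allBits (suc m)) (λ a → ∑ (allBits n) (λ b → f (a Vec.++ b))) ∎
  where open ≡-Reasoning

take-++ : ∀ {A : Set} m {n} (xs : Vec A m) (ys : Vec A n) → Vec.take m (xs Vec.++ ys) ≡ xs
take-++ zero    []       ys = refl
take-++ (suc m) (x ∷ xs) ys = cong (x ∷_) (take-++ m xs ys)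

drop-++ : ∀ {A : Set} m {n} (xs : Vec A m) (ys : Vec A n) → Vec.drop m (xs Vec.++ ys) ≡ ys
drop-++ zero    []       ys = refl
drop-++ (suc m) (x ∷ xs) ys = drop-++ m xs ys

-- Balance of random colour classes

∑-allFin-suc : ∀ n (f : Fin (suc n) → ℕ) → ∑ (allFin (suc n)) f ≡ f zero + ∑ (allFin n) (f ∘ suc)
∑-allFin-suc n f = cong (λ l → f zero + sum l)
  (trans (map-tabulate suc f) (sym (map-tabulate (λ i → i) (f ∘ suc))))

_==_ : ∀ {m} → Bits m → Bits m → Bool
u == v = does (≡-dec Bool._≟_ u v)

chunk : ∀ n L → Bits (n * L) → Fin n → Bits L
chunk (suc n) L β zero    = Vec.take L β
chunk (suc n) L β (suc i) = chunk n L (Vec.drop L β) i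

-- The first j bits; padded when fewer are available, which keeps the function total.
colour : ∀ {L} j → Bits L → Bits j
colour zero    _       = []
colour (suc j) []      = false ∷ colour j []
colour (suc j) (b ∷ v) = b ∷ colour j v

-- The first `j` bits are uniform: each bit of `κ` is matched by exactly one half of the remaining
-- strings. The product form replaces division by `2 ^ j`.
∑-colour : ∀ {j L} → j ≤ L → (κ : Bits j) → ∑ (allBits L) (λ a → ⟦ colour j a == κ ⟧) * 2 ^ j ≡ 2 ^ L
∑-colour {zero}  {L} z≤n [] =
  trans (*-identityʳ _) (trans (∑-const (allBits L) 1) (trans (*-identityʳ _) (length-allBits L)))
∑-colour {suc j} {suc L} (s≤s j≤L) (k ∷ κ) = begin
  ∑ (allBits (suc L)) (λ a → ⟦ colour (suc j) a == (k ∷ κ) ⟧) * 2 ^ suc j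
    ≡⟨ cong (_* 2 ^ suc j) (∑-allBits-suc L _) ⟩
  (S true + S false) * (2 * 2 ^ j)
    ≡⟨ cong (_* (2 * 2 ^ j)) (halves k) ⟩
  S₀ * (2 * 2 ^ j)
    ≡⟨ lem S₀ (2 ^ j) ⟩
  2 * (S₀ * 2 ^ j)
    ≡⟨ cong (2 *_) (∑-colour j≤L κ) ⟩
  2 ^ suc L ∎
  where
  open ≡-Reasoning
  S : Bool → ℕ
  S b = ∑ (allBits L) (λ a → ⟦ (b ∷ colour j a) == (k ∷ κ) ⟧)
  S₀ = ∑ (allBits L) (λ a → ⟦ colour j a == κ ⟧)
  lem : ∀ a b → a * (2 * b) ≡ 2 * (a * b)
  lem = solve-∀
  none : ∑ (allBits L) (λ _ → 0) ≡ 0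
  none = trans (∑-const (allBits L) 0) (*-zeroʳ (length (allBits L)))
  halves : ∀ k → ∑ (allBits L) (λ a → ⟦ (true ∷ colour j a) == (k ∷ κ) ⟧) +
                 ∑ (allBits L) (λ a → ⟦ (false ∷ colour j a) == (k ∷ κ) ⟧) ≡ S₀
  halves true  = trans (cong (S₀ +_) none) (+-identityʳ S₀)
  halves false = cong (_+ S₀) none

-- Chernoff factor of one item, (17/16)^e · (16/17)^e′, multiplied by 272 = 16 · 17 to make it an
-- integer.
wt : Bool → Bool → ℕ
wt true  true  = 272
wt true  false = 289
wt false true  = 256
wt false false = 272

-- Linearises the factor in the two indicators. All cases are equalities except the one where both
-- hold, which can occur only for equal colours.
wt-≤ : ∀ e e′ → wt e e′ + 16 * ⟦ e′ ⟧ ≤ 272 + 17 * ⟦ e ⟧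
wt-≤ true  true  = n≤1+n 288
wt-≤ true  false = ≤-refl
wt-≤ false true  = ≤-refl
wt-≤ false false = ≤-refl

-- Both indicators have mean 1/2ʲ, so the linear bound `wt-≤` leaves an excess of only 17 - 16 = 1
-- times 1/2ʲ over 272. The term `16 * 2 ^ L` is added on both sides to avoid subtraction.
∑-wt : ∀ {j L} → j ≤ L → (κ κ′ : Bits j) →
  ∑ (allBits L) (λ a → wt (colour j a == κ) (colour j a == κ′)) * 2 ^ j ≤ 2 ^ L * (272 * 2 ^ j + 1)
∑-wt {j} {L} j≤L κ κ′ = +-cancelʳ-≤ (16 * 2 ^ L) _ _ (begin
  W * M + 16 * 2 ^ L                      ≡⟨ cong (λ t → W * M + 16 * t) (∑-colour j≤L κ′) ⟨
  W * M + 16 * (C κ′ * M)                 ≡⟨ lem₁ W M (C κ′) ⟩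
  (W + 16 * C κ′) * M                     ≤⟨ *-monoˡ-≤ M ineq ⟩
  (2 ^ L * 272 + 17 * C κ) * M            ≡⟨ lem₂ (2 ^ L) M (C κ) ⟩
  2 ^ L * (272 * M) + 17 * (C κ * M)      ≡⟨ cong (λ t → 2 ^ L * (272 * M) + 17 * t) (∑-colour j≤L κ) ⟩
  2 ^ L * (272 * M) + 17 * 2 ^ L          ≡⟨ lem₃ (2 ^ L) (272 * M) ⟩
  2 ^ L * (272 * M + 1) + 16 * 2 ^ L      ∎)
  where
  open ≤-Reasoning
  M = 2 ^ j
  W = ∑ (allBits L) (λ a → wt (colour j a == κ) (colour j a == κ′))
  C : Bits j → ℕ
  C κ = ∑ (allBits L) (λ a → ⟦ colour j a == κ ⟧)
  lem₁ : ∀ w m c → w * m + 16 * (c * m) ≡ (w + 16 * c) * m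
  lem₁ = solve-∀
  lem₂ : ∀ l m c → (l * 272 + 17 * c) * m ≡ l * (272 * m) + 17 * (c * m)
  lem₂ = solve-∀
  lem₃ : ∀ l m → l * m + 17 * l ≡ l * (m + 1) + 16 * l
  lem₃ = solve-∀
  ineq : W + 16 * C κ′ ≤ 2 ^ L * 272 + 17 * C κ
  ineq = begin
    W + 16 * C κ′
      ≡⟨ cong (W +_) (∑-*ˡ (allBits L) _ 16) ⟨
    W + ∑ (allBits L) (λ a → 16 * ⟦ colour j a == κ′ ⟧)
      ≡⟨ ∑-+ (allBits L) _ _ ⟨
    ∑ (allBits L) (λ a → wt (colour j a == κ) (colour j a == κ′) + 16 * ⟦ colour j a == κ′ ⟧)
      ≤⟨ ∑-mono (allBits L) (λ a → wt-≤ (colour j a == κ) (colour j a == κ′)) ⟩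
    ∑ (allBits L) (λ a → 272 + 17 * ⟦ colour j a == κ ⟧)
      ≡⟨ ∑-+ (allBits L) _ _ ⟩
    ∑ (allBits L) (λ _ → 272) + ∑ (allBits L) (λ a → 17 * ⟦ colour j a == κ ⟧)
      ≡⟨ cong₂ _+_ (trans (∑-const (allBits L) 272) (cong (_* 272) (length-allBits L))) (∑-*ˡ (allBits L) _ 17) ⟩
    2 ^ L * 272 + 17 * C κ ∎

-- Counts over all of `Fin n`, with membership in a group absorbed into `q`; induction on `n` can
-- then expose one item and its own block of bits at a time.
classSize : ∀ {n L} j → (Fin n → Bool) → Bits j → Bits (n * L) → ℕ
classSize {n} {L} j q κ β = count (λ i → q i ∧ (colour j (chunk n L β i) == κ)) (allFin n)

classSize-++ : ∀ {n L} j q κ (a : Bits L) (b : Bits (n * L)) →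
  classSize {suc n} {L} j q κ (a Vec.++ b) ≡ ⟦ q zero ∧ (colour j a == κ) ⟧ + classSize {n} {L} j (q ∘ suc) κ b
classSize-++ {n} {L} j q κ a b = trans (∑-allFin-suc n _)
  (cong₂ (λ a b → ⟦ q zero ∧ (colour j a == κ) ⟧ + classSize {n} {L} j (q ∘ suc) κ b)
         (take-++ L a b) (drop-++ L a b))

-- Exposing one item shifts the two offsets by its indicators. Taking the resulting powers of 16 and
-- 17 out of the hypothesis leaves exactly the factor `wt e e′`.
tail-step : ∀ e e′ I r p Y Z →
  I * (17 ^ (⟦ e′ ⟧ + r) * 16 ^ (⟦ e ⟧ + p) * Y) ≤ 16 ^ (⟦ e′ ⟧ + r) * 17 ^ (⟦ e ⟧ + p) * Z →
  I * (17 ^ r * 16 ^ p * Y) * 272 ≤ 16 ^ r * 17 ^ p * Z * wt e e′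
tail-step true true I r p Y Z h = begin
  I * (17 ^ r * 16 ^ p * Y) * 272             ≡⟨ lem I (17 ^ r) (16 ^ p) Y ⟩
  I * (17 * 17 ^ r * (16 * 16 ^ p) * Y)       ≤⟨ h ⟩
  16 * 16 ^ r * (17 * 17 ^ p) * Z             ≡⟨ lem′ (16 ^ r) (17 ^ p) Z ⟩
  16 ^ r * 17 ^ p * Z * 272                   ∎
  where
  open ≤-Reasoning
  lem : ∀ i a b y → i * (a * b * y) * 272 ≡ i * (17 * a * (16 * b) * y)
  lem = solve-∀
  lem′ : ∀ a b z → 16 * a * (17 * b) * z ≡ a * b * z * 272
  lem′ = solve-∀
tail-step true false I r p Y Z h = begin
  I * (17 ^ r * 16 ^ p * Y) * 272             ≡⟨ lem I (17 ^ r) (16 ^ p) Y ⟩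
  I * (17 ^ r * (16 * 16 ^ p) * Y) * 17       ≤⟨ *-monoˡ-≤ 17 h ⟩
  16 ^ r * (17 * 17 ^ p) * Z * 17             ≡⟨ lem′ (16 ^ r) (17 ^ p) Z ⟩
  16 ^ r * 17 ^ p * Z * 289                   ∎
  where
  open ≤-Reasoning
  lem : ∀ i a b y → i * (a * b * y) * 272 ≡ i * (a * (16 * b) * y) * 17
  lem = solve-∀
  lem′ : ∀ a b z → a * (17 * b) * z * 17 ≡ a * b * z * 289
  lem′ = solve-∀
tail-step false true I r p Y Z h = begin
  I * (17 ^ r * 16 ^ p * Y) * 272             ≡⟨ lem I (17 ^ r) (16 ^ p) Y ⟩
  I * (17 * 17 ^ r * 16 ^ p * Y) * 16         ≤⟨ *-monoˡ-≤ 16 h ⟩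
  16 * 16 ^ r * 17 ^ p * Z * 16               ≡⟨ lem′ (16 ^ r) (17 ^ p) Z ⟩
  16 ^ r * 17 ^ p * Z * 256                   ∎
  where
  open ≤-Reasoning
  lem : ∀ i a b y → i * (a * b * y) * 272 ≡ i * (17 * a * b * y) * 16
  lem = solve-∀
  lem′ : ∀ a b z → 16 * a * b * z * 16 ≡ a * b * z * 256
  lem′ = solve-∀
tail-step false false I r p Y Z h = *-monoˡ-≤ 272 h

-- Chernoff's method, with the factor 17/16 per item of colour κ and 16/17 per item of colour κ′:
-- the expected factor of a single item exceeds 1 by only 1/(272·2ʲ).
tail : ∀ {n L j} → j ≤ L → (q : Fin n → Bool) (κ κ′ : Bits j) (p r : ℕ) →
  ∑ (allBits (n * L)) (λ β → ⟦ classSize {n} {L} j q κ′ β + r ≤ᵇ classSize {n} {L} j q κ β + p ⟧)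
    * (17 ^ r * 16 ^ p * (272 * 2 ^ j) ^ count q (allFin n))
  ≤ 16 ^ r * 17 ^ p * ((272 * 2 ^ j + 1) ^ count q (allFin n) * 2 ^ (n * L))
tail {zero} j≤L q κ κ′ p r with r ≤ᵇ p in eq
... | false = z≤n
-- Without items both class sizes are 0 and the event is just `r ≤ p`; with `p = r + d` the claim
-- reduces to 16ᵈ ≤ 17ᵈ.
... | true with d , refl ← m≤n⇒∃[o]m+o≡n (≤ᵇ⇒≤ r p (subst T (sym eq) _)) = begin
  1 * (17 ^ r * 16 ^ (r + d) * 1)       ≡⟨ cong (λ t → 1 * (17 ^ r * t * 1)) (^-distribˡ-+-* 16 r d) ⟩
  1 * (17 ^ r * (16 ^ r * 16 ^ d) * 1)  ≡⟨ lem (17 ^ r) (16 ^ r) (16 ^ d) ⟩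
  16 ^ r * (17 ^ r * 16 ^ d) * 1        ≤⟨ *-monoˡ-≤ 1 (*-monoʳ-≤ (16 ^ r) (*-monoʳ-≤ (17 ^ r) (^-monoˡ-≤ d (n≤1+n 16)))) ⟩
  16 ^ r * (17 ^ r * 17 ^ d) * 1        ≡⟨ cong (λ t → 16 ^ r * t * 1) (^-distribˡ-+-* 17 r d) ⟨
  16 ^ r * 17 ^ (r + d) * 1             ∎
  where
  open ≤-Reasoning
  lem : ∀ a b c → 1 * (a * (b * c) * 1) ≡ b * (a * c) * 1
  lem = solve-∀
tail {suc n} {L} {j} j≤L q κ κ′ p r = begin
  ∑ (allBits (L + n * L)) I * (17 ^ r * 16 ^ p * (272 * M) ^ count q (allFin (suc n)))
    ≡⟨ cong₂ (λ s t → s * (17 ^ r * 16 ^ p * (272 * M) ^ t)) (∑-allBits-+ L (n * L) I) (∑-allFin-suc n (⟦_⟧ ∘ q)) ⟩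
  ∑ (allBits L) (λ a → ∑ (allBits (n * L)) (λ b → I (a Vec.++ b))) * (17 ^ r * 16 ^ p * (272 * M) ^ (⟦ q zero ⟧ + k))
    ≡⟨ cong (_* (17 ^ r * 16 ^ p * (272 * M) ^ (⟦ q zero ⟧ + k)))
         (∑-cong (allBits L) (λ a → ∑-cong (allBits (n * L)) (λ b → shape a b))) ⟩
  ∑ (allBits L) (λ a → E (q zero ∧ (colour j a == κ)) (q zero ∧ (colour j a == κ′))) * (17 ^ r * 16 ^ p * (272 * M) ^ (⟦ q zero ⟧ + k))
    ≤⟨ main (q zero) ⟩
  16 ^ r * 17 ^ p * ((272 * M + 1) ^ (⟦ q zero ⟧ + k) * 2 ^ (L + n * L))
    ≡⟨ cong (λ t → 16 ^ r * 17 ^ p * ((272 * M + 1) ^ t * 2 ^ (L + n * L))) (∑-allFin-suc n (⟦_⟧ ∘ q)) ⟨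
  16 ^ r * 17 ^ p * ((272 * M + 1) ^ count q (allFin (suc n)) * 2 ^ (L + n * L)) ∎
  where
  open ≤-Reasoning
  M = 2 ^ j
  N = 2 ^ (n * L)
  k = count (q ∘ suc) (allFin n)
  I : Bits (L + n * L) → ℕ
  I β = ⟦ classSize {suc n} {L} j q κ′ β + r ≤ᵇ classSize {suc n} {L} j q κ β + p ⟧
  X : Bits j → Bits (n * L) → ℕ
  X = classSize {n} {L} j (q ∘ suc)
  E : Bool → Bool → ℕ
  E e e′ = ∑ (allBits (n * L)) (λ b → ⟦ X κ′ b + (⟦ e′ ⟧ + r) ≤ᵇ X κ b + (⟦ e ⟧ + p) ⟧)
  re : ∀ a b c → a + b + c ≡ b + (a + c)
  re = solve-∀
  shape : ∀ a b → I (a Vec.++ b) ≡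
    ⟦ X κ′ b + (⟦ q zero ∧ (colour j a == κ′) ⟧ + r) ≤ᵇ X κ b + (⟦ q zero ∧ (colour j a == κ) ⟧ + p) ⟧
  shape a b = cong₂ (λ s t → ⟦ s ≤ᵇ t ⟧)
    (trans (cong (_+ r) (classSize-++ {n} {L} j q κ′ a b)) (re ⟦ q zero ∧ (colour j a == κ′) ⟧ (X κ′ b) r))
    (trans (cong (_+ p) (classSize-++ {n} {L} j q κ a b)) (re ⟦ q zero ∧ (colour j a == κ) ⟧ (X κ b) p))
  main : ∀ q₀ → ∑ (allBits L) (λ a → E (q₀ ∧ (colour j a == κ)) (q₀ ∧ (colour j a == κ′)))
                  * (17 ^ r * 16 ^ p * (272 * M) ^ (⟦ q₀ ⟧ + k))
                ≤ 16 ^ r * 17 ^ p * ((272 * M + 1) ^ (⟦ q₀ ⟧ + k) * 2 ^ (L + n * L))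
  -- An item outside `q` changes neither count, so its bits contribute only the factor `2 ^ L`.
  main false = begin
    ∑ (allBits L) (λ a → E false false) * U
      ≡⟨ cong (_* U) (trans (∑-const (allBits L) (E false false)) (cong (_* E false false) (length-allBits L))) ⟩
    2 ^ L * E false false * U
      ≡⟨ *-assoc (2 ^ L) (E false false) U ⟩
    2 ^ L * (E false false * U)
      ≤⟨ *-monoʳ-≤ (2 ^ L) (tail j≤L (q ∘ suc) κ κ′ p r) ⟩
    2 ^ L * (16 ^ r * 17 ^ p * ((272 * M + 1) ^ k * N))
      ≡⟨ lem (2 ^ L) (16 ^ r * 17 ^ p) ((272 * M + 1) ^ k) N ⟩
    16 ^ r * 17 ^ p * ((272 * M + 1) ^ k * (2 ^ L * N))
      ≡⟨ cong (λ t → 16 ^ r * 17 ^ p * ((272 * M + 1) ^ k * t)) (^-distribˡ-+-* 2 L (n * L)) ⟨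
    16 ^ r * 17 ^ p * ((272 * M + 1) ^ k * 2 ^ (L + n * L)) ∎
    where
    U = 17 ^ r * 16 ^ p * (272 * M) ^ k
    lem : ∀ l a b c → l * (a * (b * c)) ≡ a * (b * (l * c))
    lem = solve-∀
  main true = begin
    ∑ (allBits L) E′ * (17 ^ r * 16 ^ p * (272 * M * Y))
      ≡⟨ lem₁ (∑ (allBits L) E′) (17 ^ r * 16 ^ p) M Y ⟩
    ∑ (allBits L) E′ * (17 ^ r * 16 ^ p * Y * 272) * M
      ≡⟨ cong (_* M) (∑-*ʳ (allBits L) E′ _) ⟨
    ∑ (allBits L) (λ a → E′ a * (17 ^ r * 16 ^ p * Y * 272)) * M
      ≤⟨ *-monoˡ-≤ M (∑-mono (allBits L) step) ⟩
    ∑ (allBits L) (λ a → 16 ^ r * 17 ^ p * Z * w a) * M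
      ≡⟨ cong (_* M) (∑-*ˡ (allBits L) w (16 ^ r * 17 ^ p * Z)) ⟩
    16 ^ r * 17 ^ p * Z * ∑ (allBits L) w * M
      ≡⟨ *-assoc (16 ^ r * 17 ^ p * Z) _ M ⟩
    16 ^ r * 17 ^ p * Z * (∑ (allBits L) w * M)
      ≤⟨ *-monoʳ-≤ (16 ^ r * 17 ^ p * Z) (∑-wt j≤L κ κ′) ⟩
    16 ^ r * 17 ^ p * ((272 * M + 1) ^ k * N) * (2 ^ L * (272 * M + 1))
      ≡⟨ lem₂ (16 ^ r * 17 ^ p) ((272 * M + 1) ^ k) N (2 ^ L) (272 * M + 1) ⟩
    16 ^ r * 17 ^ p * ((272 * M + 1) * (272 * M + 1) ^ k * (2 ^ L * N))
      ≡⟨ cong (λ t → 16 ^ r * 17 ^ p * ((272 * M + 1) ^ suc k * t)) (^-distribˡ-+-* 2 L (n * L)) ⟨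
    16 ^ r * 17 ^ p * ((272 * M + 1) ^ suc k * 2 ^ (L + n * L)) ∎
    where
    Y = (272 * M) ^ k
    Z = (272 * M + 1) ^ k * N
    E′ : Bits L → ℕ
    E′ a = E (colour j a == κ) (colour j a == κ′)
    w : Bits L → ℕ
    w a = wt (colour j a == κ) (colour j a == κ′)
    lem₁ : ∀ s a m y → s * (a * (272 * m * y)) ≡ s * (a * y * 272) * m
    lem₁ = solve-∀
    lem₂ : ∀ a b c l d → a * (b * c) * (l * d) ≡ a * (d * b * (l * c))
    lem₂ = solve-∀
    step : ∀ a → E′ a * (17 ^ r * 16 ^ p * Y * 272) ≤ 16 ^ r * 17 ^ p * Z * w a
    step a = ≤-trans (≤-reflexive (sym (*-assoc (E′ a) (17 ^ r * 16 ^ p * Y) 272)))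
      (tail-step (colour j a == κ) (colour j a == κ′) (E′ a) r p Y Z
        -- The induction hypothesis is used at offsets that already include the exposed item; this
        -- is why `tail` is stated for general `p` and `r`.
        (tail j≤L (q ∘ suc) κ κ′ (⟦ colour j a == κ ⟧ + p) (⟦ colour j a == κ′ ⟧ + r)))

-- From the Chernoff factors to a failure probability

-- This is (1 + 1/N)ⁱ ≤ N/(N - i), cleared of denominators. Passing from `i` to `i + 1` needs (N +
-- 1)d ≤ N(d + 1) with d = N - i - 1, that is d ≤ N. Once `i` reaches `N`, truncated subtraction
-- makes the left side 0.
1+1/N-power : ∀ N i → suc N ^ i * (N ∸ i) ≤ N ^ suc i
1+1/N-power N zero    = ≤-reflexive (*-comm 1 N)
1+1/N-power N (suc i) with suc i ≤? N
... | no i≰N rewrite m≤n⇒m∸n≡0 (<⇒≤ (≰⇒> i≰N)) | *-zeroʳ (suc N ^ suc i) = z≤n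
... | yes i≤N with d , refl ← m≤n⇒∃[o]m+o≡n i≤N = begin
  suc N ^ suc i * (suc i + d ∸ suc i)   ≡⟨ cong (suc N ^ suc i *_) (m+n∸m≡n (suc i) d) ⟩
  suc N * suc N ^ i * d                 ≡⟨ lem (suc N) (suc N ^ i) d ⟩
  suc N ^ i * (suc N * d)               ≤⟨ *-monoʳ-≤ (suc N ^ i) ineq ⟩
  suc N ^ i * (N * suc d)               ≡⟨ lem′ N (suc N ^ i) (suc d) ⟩
  N * (suc N ^ i * suc d)               ≡⟨ cong (λ t → N * (suc N ^ i * t)) eq ⟨
  N * (suc N ^ i * (N ∸ i))             ≤⟨ *-monoʳ-≤ N (1+1/N-power N i) ⟩
  N * N ^ suc i                         ∎
  where
  open ≤-Reasoning
  lem : ∀ a b c → a * b * c ≡ b * (a * c)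
  lem = solve-∀
  lem′ : ∀ a b c → b * (a * c) ≡ a * (b * c)
  lem′ = solve-∀
  eq : suc i + d ∸ i ≡ suc d
  eq = trans (cong (_∸ i) (sym (+-suc i d))) (m+n∸m≡n i (suc d))
  ineq : suc (suc i + d) * d ≤ (suc i + d) * suc d
  ineq = begin
    suc (suc i + d) * d                 ≤⟨ m≤m+n _ (suc i) ⟩
    suc (suc i + d) * d + suc i         ≡⟨ poly i d ⟩
    (suc i + d) * suc d                 ∎
    where
    poly : ∀ i d → suc (suc i + d) * d + suc i ≡ (suc i + d) * suc d
    poly = solve-∀

^-distribʳ-* : ∀ a b e → (a * b) ^ e ≡ a ^ e * b ^ e
^-distribʳ-* a b zero    = refl
^-distribʳ-* a b (suc e) rewrite ^-distribʳ-* a b e = lem a b (a ^ e) (b ^ e)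
  where
  lem : ∀ a b c d → a * b * (c * d) ≡ a * c * (b * d)
  lem = solve-∀

-- (1 + 1/(272M))ᵏ ≤ (272/271)ᵗ, cleared of denominators.
growth : ∀ M .{{_ : NonZero M}} k t → k ≤ t * M →
         (272 * M + 1) ^ k * 271 ^ t ≤ 272 ^ t * (272 * M) ^ k
growth M k t k≤tM with d , eq ← m≤n⇒∃[o]m+o≡n k≤tM = *-cancelʳ-≤ _ _ (N ^ d) {{m^n≢0 N d}} (begin
  -- The exponent `k` is padded by `d` to the exact multiple `t * M`, so that the estimate `one` for
  -- `M` factors can be raised to the power `t`.
  (N + 1) ^ k * 271 ^ t * N ^ d           ≤⟨ *-monoʳ-≤ ((N + 1) ^ k * 271 ^ t) (^-monoˡ-≤ d (m≤m+n N 1)) ⟩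
  (N + 1) ^ k * 271 ^ t * (N + 1) ^ d     ≡⟨ lem₁ ((N + 1) ^ k) (271 ^ t) ((N + 1) ^ d) ⟩
  (N + 1) ^ k * (N + 1) ^ d * 271 ^ t     ≡⟨ cong (_* 271 ^ t) (^-distribˡ-+-* (N + 1) k d) ⟨
  (N + 1) ^ (k + d) * 271 ^ t             ≡⟨ cong (λ e → (N + 1) ^ e * 271 ^ t) (trans eq (*-comm t M)) ⟩
  (N + 1) ^ (M * t) * 271 ^ t             ≡⟨ cong (_* 271 ^ t) (^-*-assoc (N + 1) M t) ⟨
  ((N + 1) ^ M) ^ t * 271 ^ t             ≡⟨ ^-distribʳ-* ((N + 1) ^ M) 271 t ⟨
  ((N + 1) ^ M * 271) ^ t                 ≤⟨ ^-monoˡ-≤ t one ⟩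
  (272 * N ^ M) ^ t                       ≡⟨ ^-distribʳ-* 272 (N ^ M) t ⟩
  272 ^ t * (N ^ M) ^ t                   ≡⟨ cong (272 ^ t *_) (^-*-assoc N M t) ⟩
  272 ^ t * N ^ (M * t)                   ≡⟨ cong (λ e → 272 ^ t * N ^ e) (trans (*-comm M t) (sym eq)) ⟩
  272 ^ t * N ^ (k + d)                   ≡⟨ cong (272 ^ t *_) (^-distribˡ-+-* N k d) ⟩
  272 ^ t * (N ^ k * N ^ d)               ≡⟨ *-assoc (272 ^ t) (N ^ k) (N ^ d) ⟨
  272 ^ t * N ^ k * N ^ d                 ∎)
  where
  open ≤-Reasoning
  N = 272 * M
  instance _ = m*n≢0 272 M
  lem₁ : ∀ a b c → a * b * c ≡ a * c * b
  lem₁ = solve-∀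
  lem₂ : ∀ a m → a * 271 * m ≡ a * (271 * m)
  lem₂ = solve-∀
  lem₃ : ∀ a m → 272 * m * a ≡ 272 * a * m
  lem₃ = solve-∀
  lem₄ : ∀ m → 272 * m ≡ 271 * m + m
  lem₄ = solve-∀
  -- With N = 272M, the bound N/(N - M) of `1+1/N-power` is 272/271.
  one : (N + 1) ^ M * 271 ≤ 272 * N ^ M
  one = *-cancelʳ-≤ _ _ M (begin
    (N + 1) ^ M * 271 * M     ≡⟨ lem₂ ((N + 1) ^ M) M ⟩
    (N + 1) ^ M * (271 * M)   ≡⟨ cong₂ (λ a b → a ^ M * b) (+-comm N 1) (trans (sym (m+n∸n≡m (271 * M) M)) (cong (_∸ M) (sym (lem₄ M)))) ⟩
    suc N ^ M * (N ∸ M)       ≤⟨ 1+1/N-power N M ⟩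
    N * N ^ M                 ≡⟨ lem₃ (N ^ M) M ⟩
    272 * N ^ M * M           ∎)

⟦⟧-mono : ∀ {a b} → (T a → T b) → ⟦ a ⟧ ≤ ⟦ b ⟧
⟦⟧-mono {false}         h = z≤n
⟦⟧-mono {true}  {true}  h = ≤-refl
⟦⟧-mono {true}  {false} h with () ← h _

<ᵇ-≤ᵇ : ∀ m n → ⟦ m <ᵇ n ⟧ ≤ ⟦ m ≤ᵇ n + 0 ⟧
<ᵇ-≤ᵇ m n = ⟦⟧-mono (λ h → ≤⇒≤ᵇ (≤-trans (<⇒≤ (<ᵇ⇒< m n h)) (m≤m+n n 0)))

-- An excess of δ = 23c costs the factor (16/17)^δ, while the hypothesis that the mean class size is
-- at most 8δ limits the growth of the expectation to (272/271)^(8δ). Together they give probability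
-- at most 1/2ᶜ.
tail-bound : ∀ {n L j} → j ≤ L → (q : Fin n → Bool) (κ κ′ : Bits j) (c : ℕ) →
  count q (allFin n) ≤ 8 * (23 * c) * 2 ^ j →
  ∑ (allBits (n * L)) (λ β → ⟦ classSize {n} {L} j q κ′ β + 23 * c <ᵇ classSize {n} {L} j q κ β ⟧) * 2 ^ c
  ≤ 2 ^ (n * L)
tail-bound {n} {L} {j} j≤L q κ κ′ c k≤ = *-cancelʳ-≤ _ _ (D * Y) {{m*n≢0 D Y}} (begin
  S * 2 ^ c * (D * Y)
    ≡⟨ lem₁ S (2 ^ c) D Y ⟩
  S * Y * (2 ^ c * D)
    ≤⟨ *-monoʳ-≤ (S * Y) constants ⟩
  S * Y * (17 ^ δ * 271 ^ (8 * δ))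
    ≡⟨ lem₂ S Y (17 ^ δ) (271 ^ (8 * δ)) ⟩
  S * (17 ^ δ * 1 * Y) * 271 ^ (8 * δ)
    ≤⟨ *-monoˡ-≤ (271 ^ (8 * δ)) (*-monoˡ-≤ (17 ^ δ * 1 * Y) (∑-mono (allBits (n * L)) weaken)) ⟩
  _ ≤⟨ *-monoˡ-≤ (271 ^ (8 * δ)) (tail {n} {L} j≤L q κ κ′ 0 δ) ⟩
  16 ^ δ * 1 * ((272 * M + 1) ^ k * 2 ^ (n * L)) * 271 ^ (8 * δ)
    ≡⟨ lem₃ (16 ^ δ) ((272 * M + 1) ^ k) (2 ^ (n * L)) (271 ^ (8 * δ)) ⟩
  (272 * M + 1) ^ k * 271 ^ (8 * δ) * (16 ^ δ * 2 ^ (n * L))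
    ≤⟨ *-monoˡ-≤ (16 ^ δ * 2 ^ (n * L)) (growth M k (8 * δ) k≤) ⟩
  272 ^ (8 * δ) * Y * (16 ^ δ * 2 ^ (n * L))
    ≡⟨ lem₄ (272 ^ (8 * δ)) Y (16 ^ δ) (2 ^ (n * L)) ⟩
  2 ^ (n * L) * (D * Y) ∎)
  where
  open ≤-Reasoning
  δ = 23 * c
  M = 2 ^ j
  k = count q (allFin n)
  instance
    _ = m^n≢0 2 j
    _ = m*n≢0 272 M
    _ = m^n≢0 (272 * M) k
    _ = m^n≢0 16 δ
    _ = m^n≢0 272 (8 * δ)
    _ = m*n≢0 (16 ^ δ) (272 ^ (8 * δ))
  D = 16 ^ δ * 272 ^ (8 * δ)
  Y = (272 * M) ^ k
  S = ∑ (allBits (n * L)) (λ β → ⟦ classSize {n} {L} j q κ′ β + δ <ᵇ classSize {n} {L} j q κ β ⟧)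
  weaken : ∀ β → ⟦ classSize {n} {L} j q κ′ β + δ <ᵇ classSize {n} {L} j q κ β ⟧
               ≤ ⟦ classSize {n} {L} j q κ′ β + δ ≤ᵇ classSize {n} {L} j q κ β + 0 ⟧
  weaken β = <ᵇ-≤ᵇ (classSize {n} {L} j q κ′ β + δ) (classSize {n} {L} j q κ β)
  -- δ and the growth constant are chosen so that 2 · (16/17)²³ · (272/271)¹⁸⁴ ≤ 1.
  constants : 2 ^ c * D ≤ 17 ^ δ * 271 ^ (8 * δ)
  constants = begin
    2 ^ c * (16 ^ (23 * c) * 272 ^ (8 * (23 * c)))
      ≡⟨ cong₂ (λ a b → 2 ^ c * (a * b)) (sym (^-*-assoc 16 23 c))
           (trans (cong (272 ^_) (sym (*-assoc 8 23 c))) (sym (^-*-assoc 272 184 c))) ⟩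
    2 ^ c * ((16 ^ 23) ^ c * (272 ^ 184) ^ c)
      ≡⟨ cong (2 ^ c *_) (^-distribʳ-* (16 ^ 23) (272 ^ 184) c) ⟨
    2 ^ c * (16 ^ 23 * 272 ^ 184) ^ c
      ≡⟨ ^-distribʳ-* 2 (16 ^ 23 * 272 ^ 184) c ⟨
    (2 * (16 ^ 23 * 272 ^ 184)) ^ c
      ≤⟨ ^-monoˡ-≤ c (≤ᵇ⇒≤ (2 * (16 ^ 23 * 272 ^ 184)) (17 ^ 23 * 271 ^ 184) _) ⟩
    (17 ^ 23 * 271 ^ 184) ^ c
      ≡⟨ ^-distribʳ-* (17 ^ 23) (271 ^ 184) c ⟩
    (17 ^ 23) ^ c * (271 ^ 184) ^ c
      ≡⟨ cong₂ _*_ (^-*-assoc 17 23 c)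
           (trans (^-*-assoc 271 184 c) (cong (271 ^_) (*-assoc 8 23 c))) ⟩
    17 ^ δ * 271 ^ (8 * δ) ∎
  lem₁ : ∀ s c d y → s * c * (d * y) ≡ s * y * (c * d)
  lem₁ = solve-∀
  lem₂ : ∀ s y a b → s * y * (a * b) ≡ s * (a * 1 * y) * b
  lem₂ = solve-∀
  lem₃ : ∀ a b c d → a * 1 * (b * c) * d ≡ b * d * (a * c)
  lem₃ = solve-∀
  lem₄ : ∀ a y b c → a * y * (b * c) ≡ c * (b * a * y)
  lem₄ = solve-∀

-- Lists

does⁺ : ∀ {P : Set} (P? : Dec P) → P → T (does P?)
does⁺ (yes _) _ = _
does⁺ (no ¬p) p = ¬p p

does⁻ : ∀ {P : Set} (P? : Dec P) → T (does P?) → P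
does⁻ (yes p) _ = p

module _ {A : Set} where

  ∈-filterᵇ⁻ : ∀ p {x : A} xs → x ∈ filterᵇ p xs → x ∈ xs × T (p x)
  ∈-filterᵇ⁻ p xs = ∈-filter⁻ (T? ∘ p) {xs = xs}

  ∈-filterᵇ⁺ : ∀ p {x : A} {xs} → x ∈ xs → T (p x) → x ∈ filterᵇ p xs
  ∈-filterᵇ⁺ p = ∈-filter⁺ (T? ∘ p)

  ∈-drop⁻ : ∀ k {x : A} xs → x ∈ drop k xs → x ∈ xs
  ∈-drop⁻ k xs h = subst (_ ∈_) (take++drop≡id k xs) (∈-++⁺ʳ (take k xs) h)

module _ {A K : Set} (_≟ᵏ_ : DecidableEquality K) (f : A → K) where

  fibre : List A → K → List A
  fibre xs k = filterᵇ (λ x → does (f x ≟ᵏ k)) xs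

  private
    rest : K → List A → List A
    rest k = filterᵇ (λ x → not (does (f x ≟ᵏ k)))

    split : ∀ k xs → fibre xs k ++ rest k xs ↭ xs
    split k []       = ↭-refl
    split k (x ∷ xs) with does (f x ≟ᵏ k)
    ... | true  = ↭.prep x (split k xs)
    ... | false = ↭-trans (↭.shift x (fibre xs k) (rest k xs)) (↭.prep x (split k xs))

    fibre-rest : ∀ k k′ xs → k ≢ k′ → fibre (rest k xs) k′ ≡ fibre xs k′
    fibre-rest k k′ []       k≢k′ = refl
    fibre-rest k k′ (x ∷ xs) k≢k′ with f x ≟ᵏ k
    ... | yes refl with f x ≟ᵏ k′
    ...   | yes eq = ⊥-elim (k≢k′ eq)
    ...   | no _   = fibre-rest k k′ xs k≢k′
    fibre-rest k k′ (x ∷ xs) k≢k′ | no _ with does (f x ≟ᵏ k′)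
    ...   | true  = cong (x ∷_) (fibre-rest k k′ xs k≢k′)
    ...   | false = fibre-rest k k′ xs k≢k′

  -- Splitting off the fibre of the first key leaves the fibres of the other, distinct keys
  -- unchanged; every item is eventually split off because `ks` contains its key.
  concatMap-fibre : ∀ {ks} xs → Unique ks → (∀ {x} → x ∈ xs → f x ∈ ks) → concatMap (fibre xs) ks ↭ xs
  concatMap-fibre {[]}     []       _          _ = ↭-refl
  concatMap-fibre {[]}     (x ∷ xs) _          h with () ← h (here refl)
  concatMap-fibre {k ∷ ks} xs       (k∉ ∷ uks) h =
    ↭-trans (↭.++⁺ˡ (fibre xs k) (subst (_↭ rest k xs) (same ks k∉) (concatMap-fibre (rest k xs) uks h′))) (split k xs)
    where
    same : ∀ ks → All (k ≢_) ks → concatMap (fibre (rest k xs)) ks ≡ concatMap (fibre xs) ks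
    same []         []        = refl
    same (k′ ∷ ks) (ne ∷ nes) = cong₂ _++_ (fibre-rest k k′ xs ne) (same ks nes)
    h′ : ∀ {x} → x ∈ rest k xs → f x ∈ ks
    h′ {x} x∈ with ∈-filterᵇ⁻ (λ x → not (does (f x ≟ᵏ k))) xs x∈
    ... | x∈xs , t with f x ≟ᵏ k | h x∈xs
    ...   | no ne | here eq  = ⊥-elim (ne eq)
    ...   | no ne | there m  = m

Unique-allBits : ∀ m → Unique (allBits m)
Unique-allBits zero    = [] ∷ []
Unique-allBits (suc m) = Unique.++⁺
  (Unique.map⁺ ∷-injectiveʳ (Unique-allBits m))
  (Unique.map⁺ ∷-injectiveʳ (Unique-allBits m))
  disjoint
  where
  disjoint : ∀ {v : Bits (suc m)} → v ∈ map (true ∷_) (allBits m) × v ∈ map (false ∷_) (allBits m) → ⊥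
  disjoint (p , q) with ∈-map⁻ (true ∷_) p | ∈-map⁻ (false ∷_) q
  ... | _ , _ , refl | _ , _ , ()

module _ {A B : Set} where

  concatMap-++-↭ : ∀ (f g : A → List B) ks →
    concatMap f ks ++ concatMap g ks ↭ concatMap (λ k → f k ++ g k) ks
  concatMap-++-↭ f g []       = ↭-refl
  concatMap-++-↭ f g (k ∷ ks) = begin
    (f k ++ concatMap f ks) ++ g k ++ concatMap g ks   ≡⟨ ++-assoc (f k) _ _ ⟩
    f k ++ concatMap f ks ++ g k ++ concatMap g ks     ↭⟨ ↭.++⁺ˡ (f k) (↭.shifts (concatMap f ks) (g k)) ⟩
    f k ++ g k ++ concatMap f ks ++ concatMap g ks     ≡⟨ ++-assoc (f k) (g k) _ ⟨
    (f k ++ g k) ++ concatMap f ks ++ concatMap g ks   ↭⟨ ↭.++⁺ˡ (f k ++ g k) (concatMap-++-↭ f g ks) ⟩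
    (f k ++ g k) ++ concatMap (λ k → f k ++ g k) ks    ∎
    where
    open ↭.PermutationReasoning

  concatMap-↭ : ∀ {f g : A → List B} ks → (∀ k → f k ↭ g k) → concatMap f ks ↭ concatMap g ks
  concatMap-↭ []       h = ↭-refl
  concatMap-↭ (k ∷ ks) h = ↭.++⁺ (h k) (concatMap-↭ ks h)

  length-concatMap-≤ : ∀ {f : A → List B} {c} ks → (∀ {k} → k ∈ ks → length (f k) ≤ c) →
    length (concatMap f ks) ≤ length ks * c
  length-concatMap-≤ []           h = z≤n
  length-concatMap-≤ {f} (k ∷ ks) h rewrite length-++ (f k) {concatMap f ks} =
    +-mono-≤ (h (here refl)) (length-concatMap-≤ ks (h ∘ there))

  concat-concatMap : ∀ (f : A → List (List B)) ks → concat (concatMap f ks) ≡ concatMap (concat ∘ f) ks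
  concat-concatMap f []       = refl
  concat-concatMap f (k ∷ ks) = trans (sym (concat-++ (f k) (concatMap f ks))) (cong (concat (f k) ++_) (concat-concatMap f ks))

  ∈-concatMap⁻′ : ∀ (f : A → List B) {y} ks → y ∈ concatMap f ks → ∃ λ k → k ∈ ks × y ∈ f k
  ∈-concatMap⁻′ f (k ∷ ks) y∈ with ∈-++⁻ (f k) y∈
  ... | inj₁ h = k , here refl , h
  ... | inj₂ h with k′ , k′∈ , h′ ← ∈-concatMap⁻′ f ks h = k′ , there k′∈ , h′

module _ {A : Set} where

  sortBy : (A → ℕ) → List A → List A
  sortBy f = Sort.sort (On.decTotalOrder ≤-decTotalOrder f)

  sortBy-↭ : ∀ f xs → sortBy f xs ↭ xs
  sortBy-↭ f = Sort.sort-↭ (On.decTotalOrder ≤-decTotalOrder f)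

  sortBy-AllPairs : ∀ f xs → AllPairs (λ x y → f x ≤ f y) (sortBy f xs)
  sortBy-AllPairs f xs = Linked⇒AllPairs ≤-trans (Sort.sort-↗ (On.decTotalOrder ≤-decTotalOrder f) xs)

count-mono : ∀ {A : Set} (p q : A → Bool) xs → (∀ {x} → x ∈ xs → T (p x) → T (q x)) → count p xs ≤ count q xs
count-mono p q xs h = ∑-mono-∈ xs (λ x∈ → ⟦⟧-mono (h x∈))

count-≤-length : ∀ {A : Set} (p : A → Bool) xs → count p xs ≤ length xs
count-≤-length p []       = z≤n
count-≤-length p (x ∷ xs) with p x
... | true  = s≤s (count-≤-length p xs)
... | false = m≤n⇒m≤1+n (count-≤-length p xs)

count-mono-< : ∀ {A : Set} (p q : A → Bool) xs → (∀ {x} → x ∈ xs → T (p x) → T (q x)) →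
               ∀ {y} → y ∈ xs → T (q y) → ¬ T (p y) → count p xs < count q xs
count-mono-< p q (x ∷ xs) h (here refl) qy ¬py with p x | q x
... | true  | true  = ⊥-elim (¬py _)
... | false | true  = s≤s (count-mono p q xs (h ∘ there))
count-mono-< p q (x ∷ xs) h (there y∈) qy ¬py =
  +-mono-≤-< (⟦⟧-mono {p x} {q x} (h (here refl))) (count-mono-< p q xs (h ∘ there) y∈ qy ¬py)

module _ {A : Set} {S : A → A → Set} (p : A → Bool) where

  count-zero : ∀ {xs} → All (λ x → ¬ T (p x)) xs → count p xs ≡ 0
  count-zero []         = refl
  count-zero {x ∷ xs} (¬px ∷ h) with p x
  ... | false = count-zero h
  ... | true  = ⊥-elim (¬px _)

  -- Every item satisfying `p` stands strictly before `z`, and fewer than `k` positions do so.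
  count-<-take : ∀ {xs} → AllPairs S xs → ∀ {z} k → z ∈ take k xs →
                 ¬ T (p z) → (∀ {y} → S z y → ¬ T (p y)) → count p xs < k
  count-<-take {x ∷ xs} (Sx ∷ Sxs) (suc k) (here refl) ¬pz h = s≤s (≤-trans (≤-reflexive (count-zero {x ∷ xs} (¬pz ∷ All.map h Sx))) z≤n)
  count-<-take {x ∷ xs} (Sx ∷ Sxs) (suc k) (there z∈)  ¬pz h with p x
  ... | true  = s≤s (count-<-take Sxs k z∈ ¬pz h)
  ... | false = m≤n⇒m≤1+n (count-<-take Sxs k z∈ ¬pz h)

  -- At least `k` items precede `z`; they all satisfy `p`, and so does `z` itself.
  count->-drop : ∀ {xs} → AllPairs S xs → ∀ {z} k → z ∈ drop k xs →
                 T (p z) → (∀ {y} → S y z → T (p y)) → k < count p xs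
  count->-drop {xs = xs} Sxs {z} zero z∈ pz h = ≤-trans (⟦⟧-mono {true} {p z} (λ _ → pz)) (∑-∈ (⟦_⟧ ∘ p) z∈)
  count->-drop {x ∷ xs} (Sx ∷ Sxs) (suc k) z∈ pz h with p x | h (All.lookup Sx (∈-drop⁻ k xs z∈))
  ... | true | _ = s≤s (count->-drop Sxs k z∈ pz h)

-- Refining one group

module Split {n j : ℕ} (d : ℕ) (col : Fin n → Bits j) (beats : Fin n → Fin n → Bool) (g : List (Fin n)) where

  class : Bits j → List (Fin n)
  class = fibre (≡-dec Bool._≟_) col g

  -- For `j = 0` there is a single colour, so the pivots are the whole group and all pairs are
  -- compared.
  pivots : List (Fin n)
  pivots = class (Vec.replicate j false)

  score wins : Fin n → ℕ
  score z = count (beats z) pivots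
  wins  z = count (beats z) (class (col z))

  ranked : Bits j → List (Fin n)
  ranked κ = sortBy wins (class κ)

  -- A window of length 2d, meant to be centred at rank `s`. If `s < d`, it starts at 0 and its end
  -- lies beyond `s + d`; what `high` relies on is only that the window ends no earlier than
  -- `s + d`.
  low mid high : ℕ → Bits j → List (Fin n)
  low  s κ = take (s ∸ d) (ranked κ)
  mid  s κ = take (2 * d) (drop (s ∸ d) (ranked κ))
  high s κ = drop (2 * d) (drop (s ∸ d) (ranked κ))

  atScore : (ℕ → Bits j → List (Fin n)) → ℕ → List (Fin n)
  atScore part s = fibre _≟_ score (concatMap (part s) (allBits j)) s

  pieces : ℕ → List (List (Fin n))
  pieces s = map [_] (atScore low s) ++ [ atScore mid s ] ++ map [_] (atScore high s)

  refine : List (List (Fin n))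
  refine = concatMap pieces (upTo (suc (length pivots)))

  ∈-atScore : ∀ part {s z} → z ∈ atScore part s → score z ≡ s × ∃ λ κ → z ∈ part s κ
  ∈-atScore part {s} z∈ with ∈-filterᵇ⁻ (λ x → does (score x ≟ s)) _ z∈
  ... | z∈′ , t with κ , _ , z∈κ ← ∈-concatMap⁻′ (part s) (allBits j) z∈′ = does⁻ (_ ≟ s) t , κ , z∈κ

  concat-pieces : ∀ s → concat (pieces s) ↭ fibre _≟_ score g s
  concat-pieces s = begin
    concat (map [_] (F low) ++ [ F mid ] ++ map [_] (F high))
      ≡⟨ concat-++ (map [_] (F low)) _ ⟨
    concat (map [_] (F low)) ++ F mid ++ concat (map [_] (F high))
      ≡⟨ cong₂ (λ a b → a ++ F mid ++ b) (concat-map-[ F low ]) (concat-map-[ F high ]) ⟩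
    F low ++ F mid ++ F high
      ≡⟨ cong (F low ++_) (filter-++ _ (C mid) (C high)) ⟨
    F low ++ fibre _≟_ score (C mid ++ C high) s
      ≡⟨ filter-++ _ (C low) (C mid ++ C high) ⟨
    fibre _≟_ score (C low ++ C mid ++ C high) s
      ↭⟨ filter-↭ _ (↭-trans (↭.++⁺ˡ (C low) (concatMap-++-↭ (mid s) (high s) (allBits j)))
                             (concatMap-++-↭ (low s) _ (allBits j))) ⟩
    fibre _≟_ score (concatMap (λ κ → low s κ ++ mid s κ ++ high s κ) (allBits j)) s
      ↭⟨ filter-↭ _ (concatMap-↭ (allBits j) whole) ⟩
    fibre _≟_ score (concatMap class (allBits j)) s
      ↭⟨ filter-↭ _ (concatMap-fibre (≡-dec Bool._≟_) col g (Unique-allBits j) (λ _ → ∈-allBits _)) ⟩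
    fibre _≟_ score g s ∎
    where
    open ↭.PermutationReasoning
    F C : (ℕ → Bits j → List (Fin n)) → List (Fin n)
    F part = atScore part s
    C part = concatMap (part s) (allBits j)
    whole : ∀ κ → low s κ ++ mid s κ ++ high s κ ↭ class κ
    whole κ = ↭-trans (↭-reflexive (trans
      (cong (low s κ ++_) (take++drop≡id (2 * d) (drop (s ∸ d) (ranked κ))))
      (take++drop≡id (s ∸ d) (ranked κ)))) (sortBy-↭ wins (class κ))

  -- Holds for arbitrary `beats` and `col`: scores partition the group, and for each score the three
  -- parts of each class make up the class. Hence the output is a permutation even after unbalanced
  -- colourings.
  concat-refine : concat refine ↭ g
  concat-refine = begin
    concat (concatMap pieces scores)          ≡⟨ concat-concatMap pieces scores ⟩
    concatMap (concat ∘ pieces) scores        ↭⟨ concatMap-↭ scores concat-pieces ⟩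
    concatMap (fibre _≟_ score g) scores      ↭⟨ concatMap-fibre _≟_ score g (Unique.upTo⁺ _)
                                                   (λ _ → ∈-upTo⁺ (s≤s (count-≤-length _ pivots))) ⟩
    g                                         ∎
    where
    open ↭.PermutationReasoning
    scores = upTo (suc (length pivots))

  ∈-pieces : ∀ {s h z} → h ∈ pieces s → z ∈ h → score z ≡ s
  ∈-pieces {s} h∈ z∈ with ∈-++⁻ (map [_] (atScore low s)) h∈
  ... | inj₁ p with y , y∈ , refl ← ∈-map⁻ [_] p | here refl ← z∈ = proj₁ (∈-atScore low y∈)
  ... | inj₂ (here refl) = proj₁ (∈-atScore mid z∈)
  ... | inj₂ (there p) with y , y∈ , refl ← ∈-map⁻ [_] p | here refl ← z∈ = proj₁ (∈-atScore high y∈)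

  -- Only the middle pieces can have more than one item, and each takes at most 2d items from each
  -- of the `2 ^ j` classes.
  length-refine : ∀ {h} → h ∈ refine → length h ≤ 2 ^ j * (2 * d) ⊎ length h ≤ 1
  length-refine h∈ with s , _ , h∈s ← ∈-concatMap⁻′ pieces (upTo (suc (length pivots))) h∈
                   with ∈-++⁻ (map [_] (atScore low s)) h∈s
  ... | inj₁ p with _ , _ , refl ← ∈-map⁻ [_] p = inj₂ ≤-refl
  ... | inj₂ (there p) with _ , _ , refl ← ∈-map⁻ [_] p = inj₂ ≤-refl
  ... | inj₂ (here refl) = inj₁ (begin
    length (atScore mid s)                     ≤⟨ length-filter _ (concatMap (mid s) (allBits j)) ⟩
    length (concatMap (mid s) (allBits j))     ≤⟨ length-concatMap-≤ (allBits j) (λ _ → short _) ⟩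
    length (allBits j) * (2 * d)               ≡⟨ cong (_* (2 * d)) (length-allBits j) ⟩
    2 ^ j * (2 * d)                            ∎)
    where
    open ≤-Reasoning
    short : ∀ κ → length (mid s κ) ≤ 2 * d
    short κ = ≤-trans (≤-reflexive (length-take (2 * d) _)) (m⊓n≤m (2 * d) _)

-- Correctness of the refinement

-- Tolerances are counted in unit steps, so that chains of inequalities use only monotonicity of
-- `_+1`; the numeral 4 appears at the very end.
_+1 : ℚ → ℚ
q +1 = q ℚ.+ 1ℚ

infixl 8 _+1

<ℚ⇒≱ : ∀ {p q} → p ℚ.< q → ¬ q ℚ.≤ p
<ℚ⇒≱ p<q q≤p = ℚ.<-irrefl refl (ℚ.<-≤-trans p<q q≤p)

+1-mono-≤ : ∀ {p q} → p ℚ.≤ q → p +1 ℚ.≤ q +1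
+1-mono-≤ = ℚ.+-monoˡ-≤ 1ℚ

p≤p+1 : ∀ p → p ℚ.≤ p +1
p≤p+1 p = subst (ℚ._≤ p +1) (ℚ.+-identityʳ p) (ℚ.+-monoʳ-≤ p (ℚ.nonNegative⁻¹ 1ℚ))

p≤p+3 : ∀ p → p ℚ.≤ p +1 +1 +1
p≤p+3 p = ℚ.≤-trans (p≤p+1 p) (ℚ.≤-trans (p≤p+1 (p +1)) (p≤p+1 (p +1 +1)))

module Order {n : ℕ} (x : Fin n → ℚ) where

  -- The permission to place `u` before `z` in a 4-approximate sorting.
  Near : Fin n → Fin n → Set
  Near u z = x u ℚ.≤ x z +1 +1 +1 +1

  infix 4 _≼_
  _≼_ : List (Fin n) → List (Fin n) → Set
  g ≼ h = ∀ {u z} → u ∈ g → z ∈ h → Near u z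

  -- The two sets enclose the unknown set of items that `w` beats: it can beat only reachable items,
  -- and it surely beats the beaten ones among those it is compared with.
  reachable beaten : Fin n → Fin n → Bool
  reachable w y = does (x y ℚ.≤? x w +1)
  beaten    w y = does (x y +1 ℚ.<? x w)

module SplitCorrect {n j : ℕ} (d : ℕ) (col : Fin n → Bits j) (beats : Fin n → Fin n → Bool) (g : List (Fin n))
  (x : Fin n → ℚ)
  where
  open Split d col beats g
  open Order x

  Balanced : (Fin n → Bool) → Set
  Balanced q = ∀ κ κ′ → count q (class κ) ≤ count q (class κ′) + d

  module _
    (sound    : ∀ {z y} → T (beats z y) → x y ℚ.≤ x z +1)
    (complete : ∀ {z y} → z ∈ g → y ∈ g → col y ≡ col z ⊎ col y ≡ Vec.replicate j false →
                x y +1 ℚ.< x z → T (beats z y))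
    (self     : ∀ {z} → z ∈ g → T (beats z z))
    (balanced : ∀ {w} → w ∈ g → Balanced (reachable w) × Balanced (beaten w))
    where

    ∈-class⁻ : ∀ {κ z} → z ∈ class κ → z ∈ g × col z ≡ κ
    ∈-class⁻ {κ} z∈ with z∈g , t ← ∈-filterᵇ⁻ _ g z∈ = z∈g , does⁻ (≡-dec Bool._≟_ _ κ) t

    -- A win of `z` over `y` gives x y + 1 ≤ x z + 2 < x u, so the adversary has no choice between
    -- `u` and `y`.
    beats-mono : ∀ {u z y} → x z +1 +1 ℚ.< x u → u ∈ g → y ∈ g →
                 col y ≡ col u ⊎ col y ≡ Vec.replicate j false → T (beats z y) → T (beats u y)
    beats-mono z≪u u∈ y∈ c b = complete u∈ y∈ c (ℚ.≤-<-trans (+1-mono-≤ (sound b)) z≪u)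

    -- Were `u` far above `z`, it would beat every pivot that `z` beats and could not have the
    -- smaller score.
    score-< : ∀ {u z} → u ∈ g → score u < score z → Near u z
    score-< {u} {z} u∈ s<s′ = ℚ.≮⇒≥ λ z⋘u → <⇒≱ s<s′
      (count-mono (beats z) (beats u) pivots λ y∈ →
        beats-mono (ℚ.≤-<-trans (ℚ.≤-trans (p≤p+1 _) (p≤p+1 _)) z⋘u) u∈ (proj₁ (∈-class⁻ y∈)) (inj₂ (proj₂ (∈-class⁻ y∈))))

    -- If `u` exceeds `z` by more than 2, then `u` has strictly more wins within their class, so
    -- ranking by wins errs by at most 2.
    ranked-AllPairs : ∀ κ → AllPairs (λ u z → x u ℚ.≤ x z +1 +1) (ranked κ)
    ranked-AllPairs κ = relate (ranked κ) (∈-resp-↭ (sortBy-↭ wins (class κ))) (sortBy-AllPairs wins (class κ))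
      where
      ordered : ∀ {u z} → u ∈ class κ → z ∈ class κ → wins u ≤ wins z → x u ℚ.≤ x z +1 +1
      ordered {u} {z} u∈ z∈ u≤z with u∈g , refl ← ∈-class⁻ u∈ | z∈g , eq ← ∈-class⁻ z∈ = ℚ.≮⇒≥ λ z≪u →
        <⇒≱ (subst (λ κ → count (beats z) (class κ) < wins u) (sym eq)
          (count-mono-< (beats z) (beats u) (class (col u))
            (λ y∈ → beats-mono z≪u u∈g (proj₁ (∈-class⁻ y∈)) (inj₁ (proj₂ (∈-class⁻ y∈))))
            -- Strictness comes from the comparison of `u` with itself: `u` wins it, while `z`
            -- cannot beat `u`.
            u∈ (self u∈g) (λ b → <ℚ⇒≱ z≪u (ℚ.≤-trans (sound b) (p≤p+1 _))))) u≤z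
      relate : ∀ xs → (∀ {z} → z ∈ xs → z ∈ class κ) → AllPairs (λ u z → wins u ≤ wins z) xs →
               AllPairs (λ u z → x u ℚ.≤ x z +1 +1) xs
      relate []       h []       = []
      relate (u ∷ xs) h (p ∷ ps) =
        All.tabulate (λ z∈ → ordered (h (here refl)) (h (there z∈)) (All.lookup p z∈)) ∷ relate xs (h ∘ there) ps

    count-ranked : ∀ q κ → count q (ranked κ) ≡ count q (class κ)
    count-ranked q κ = ∑-↭ _ (sortBy-↭ wins (class κ))

    -- By balance, at least `score w ∸ d` items of the class are reachable from `w`. Were x z > x w
    -- + 4, the ranking error of 2 would force all of them strictly before `z`, whose rank leaves
    -- too little room.
    low-Near : ∀ {z w} κ → w ∈ g → z ∈ low (score w) κ → Near z w
    low-Near {z} {w} κ w∈ z∈ = ℚ.≮⇒≥ λ w⋘z → <⇒≱ (counted w⋘z) enough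
      where
      q = reachable w
      enough : score w ∸ d ≤ count q (ranked κ)
      enough = begin
        score w ∸ d                   ≤⟨ ∸-monoˡ-≤ d (count-mono (beats w) q pivots (λ _ b → does⁺ (_ ℚ.≤? _) (sound b))) ⟩
        count q pivots ∸ d            ≤⟨ ∸-monoˡ-≤ d (proj₁ (balanced w∈) _ κ) ⟩
        count q (class κ) + d ∸ d     ≡⟨ m+n∸n≡m _ d ⟩
        count q (class κ)             ≡⟨ count-ranked q κ ⟨
        count q (ranked κ)            ∎
        where open ≤-Reasoning
      counted : x w +1 +1 +1 +1 ℚ.< x z → count q (ranked κ) < score w ∸ d
      counted w⋘z = count-<-take q (ranked-AllPairs κ) (score w ∸ d) z∈
        (λ t → <ℚ⇒≱ w⋘z (ℚ.≤-trans (does⁻ (x z ℚ.≤? x w +1) t) (p≤p+3 (x w +1))))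
        (λ {y} z≤y t → <ℚ⇒≱ w⋘z (ℚ.≤-trans z≤y (ℚ.≤-trans (+1-mono-≤ (+1-mono-≤ (does⁻ (x y ℚ.≤? x w +1) t))) (p≤p+1 (x w +1 +1 +1)))))

    -- Were x w > x z + 4, then `z` and all items ranked before it would be beaten by `w`, more than
    -- `k` in number. Balance allows at most `score w + d ≤ k` of them.
    high-Near : ∀ {z w} κ → w ∈ g → z ∈ high (score w) κ → Near w z
    high-Near {z} {w} κ w∈ z∈ = ℚ.≮⇒≥ λ z⋘w → <⇒≱ (counted z⋘w) enough
      where
      q = beaten w
      drop-drop : ∀ a b (xs : List (Fin n)) → z ∈ drop b (drop a xs) → z ∈ drop (a + b) xs
      drop-drop zero    b xs       h = h
      drop-drop (suc a) zero []    ()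
      drop-drop (suc a) (suc b) [] ()
      drop-drop (suc a) b (_ ∷ xs) h = drop-drop a b xs h
      k = score w ∸ d + 2 * d
      enough : count q (ranked κ) ≤ k
      enough = begin
        count q (ranked κ)            ≡⟨ count-ranked q κ ⟩
        count q (class κ)             ≤⟨ proj₂ (balanced w∈) κ _ ⟩
        count q pivots + d            ≤⟨ +-monoˡ-≤ d (count-mono q (beats w) pivots (λ y∈ t →
                                           complete w∈ (proj₁ (∈-class⁻ y∈)) (inj₂ (proj₂ (∈-class⁻ y∈))) (does⁻ (_ ℚ.<? _) t))) ⟩
        score w + d                   ≤⟨ +-monoˡ-≤ d (m≤n+m∸n (score w) d) ⟩
        d + (score w ∸ d) + d         ≡⟨ lem d (score w ∸ d) ⟩
        k                             ∎
        where
        open ≤-Reasoning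
        lem : ∀ d s → d + s + d ≡ s + 2 * d
        lem = solve-∀
      counted : x z +1 +1 +1 +1 ℚ.< x w → k < count q (ranked κ)
      counted z⋘w = count->-drop q (ranked-AllPairs κ) k (drop-drop (score w ∸ d) (2 * d) (ranked κ) z∈)
        (does⁺ (x z +1 ℚ.<? x w) (ℚ.≤-<-trans (p≤p+3 (x z +1)) z⋘w))
        (λ {y} y≤z → does⁺ (x y +1 ℚ.<? x w) (ℚ.≤-<-trans (ℚ.≤-trans (+1-mono-≤ y≤z) (p≤p+1 (x z +1 +1 +1))) z⋘w))

    ∈-refine⁻ : ∀ {h z} → h ∈ refine → z ∈ h → z ∈ g
    ∈-refine⁻ h∈ z∈ = ∈-resp-↭ concat-refine (∈-concat⁺′ z∈ h∈)

    private
      scores = upTo (suc (length pivots))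

    ∈-pieces-g : ∀ {s h z} → s ∈ scores → h ∈ pieces s → z ∈ h → z ∈ g
    ∈-pieces-g s∈ h∈ = ∈-refine⁻ (∈-concatMap⁺ pieces (Any.map (λ { refl → h∈ }) s∈))

    low-≼ : ∀ {s h h′} → s ∈ scores → h ∈ map [_] (atScore low s) → h′ ∈ pieces s → h ≼ h′
    low-≼ s∈ h∈ h′∈ u∈ z∈
      with _ , y∈ , refl ← ∈-map⁻ [_] h∈ | here refl ← u∈ | refl ← ∈-pieces h′∈ z∈
      with _ , κ , y∈κ ← ∈-atScore low y∈ = low-Near κ (∈-pieces-g s∈ h′∈ z∈) y∈κ

    high-≼ : ∀ {s h h′} → s ∈ scores → h ∈ pieces s → h′ ∈ map [_] (atScore high s) → h ≼ h′
    high-≼ s∈ h∈ h′∈ u∈ z∈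
      with _ , y∈ , refl ← ∈-map⁻ [_] h′∈ | here refl ← z∈ | refl ← ∈-pieces h∈ u∈
      with _ , κ , y∈κ ← ∈-atScore high y∈ = high-Near κ (∈-pieces-g s∈ h∈ u∈) y∈κ

    -- Low singletons may precede every piece of their score, each other included, and high
    -- singletons may follow every piece; so their internal order is arbitrary. The middle is a
    -- single group and carries no order inside.
    pieces-AllPairs : ∀ {s} → s ∈ scores → AllPairs _≼_ (pieces s)
    pieces-AllPairs {s} s∈ = AllPairs.++⁺
      (everywhere lows (λ h∈ h′∈ → low-≼ s∈ h∈ (∈-++⁺ˡ h′∈)))
      (All.tabulate (λ h∈ → high-≼ s∈ (∈-++⁺ʳ lows (here refl)) h∈) ∷
       everywhere (map [_] (atScore high s)) (λ h∈ h′∈ → high-≼ s∈ (∈-++⁺ʳ lows (there h∈)) h′∈))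
      (All.tabulate λ h∈ → All.tabulate λ h′∈ → low-≼ s∈ h∈ (∈-++⁺ʳ lows h′∈))
      where
      lows = map [_] (atScore low s)
      everywhere : ∀ {A : Set} {R : A → A → Set} xs → (∀ {u z} → u ∈ xs → z ∈ xs → R u z) → AllPairs R xs
      everywhere []       h = []
      everywhere (u ∷ xs) h = All.tabulate (λ z∈ → h (here refl) (there z∈)) ∷ everywhere xs (λ a b → h (there a) (there b))

    -- Pieces of equal score are ordered by `pieces-AllPairs`, pieces of different scores by
    -- `score-<`.
    refine-AllPairs : AllPairs _≼_ refine
    refine-AllPairs = AllPairs.concat⁺
      (All.map⁺ (All.tabulate pieces-AllPairs))
      (AllPairs.map⁺ (AllPairs.applyUpTo⁺₁ _ _ λ i<j j<N →
        All.tabulate λ h∈ → All.tabulate λ h′∈ {u} {z} u∈ z∈ →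
          score-< (∈-pieces-g (∈-upTo⁺ (<-trans i<j j<N)) h∈ u∈)
                  (subst₂ _<_ (sym (∈-pieces h∈ u∈)) (sym (∈-pieces h′∈ z∈)) i<j)))

-- Comparator answers and output permutations

module _ {A : Set} {a b : A} where

  if-yes : ∀ {P : Set} (P? : Dec P) → P → (if does P? then a else b) ≡ a
  if-yes (yes _) p = refl
  if-yes (no ¬p) p = ⊥-elim (¬p p)

  if-no : ∀ {P : Set} (P? : Dec P) → ¬ P → (if does P? then a else b) ≡ b
  if-no (yes p) ¬p = ⊥-elim (¬p p)
  if-no (no _)  ¬p = refl

if-same : ∀ {A : Set} {a : A} b → (if b then a else a) ≡ a
if-same true  = refl
if-same false = refl

module _ {n : ℕ} (x : Fin n → ℚ) where

  private
    gap : ∀ {z y} → x y +1 ℚ.< x z → 1ℚ ℚ.< x z ℚ.- x y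
    gap {z} {y} h = subst (ℚ._< x z ℚ.- x y) (begin
      x y ℚ.+ 1ℚ ℚ.- x y              ≡⟨ cong (ℚ._- x y) (ℚ.+-comm (x y) 1ℚ) ⟩
      1ℚ ℚ.+ x y ℚ.- x y              ≡⟨ ℚ.+-assoc 1ℚ (x y) (ℚ.- x y) ⟩
      1ℚ ℚ.+ (x y ℚ.- x y)            ≡⟨ cong (1ℚ ℚ.+_) (ℚ.+-inverseʳ (x y)) ⟩
      1ℚ ℚ.+ ℚ.0ℚ                     ≡⟨ ℚ.+-identityʳ 1ℚ ⟩
      1ℚ                              ∎) (ℚ.+-monoˡ-< (ℚ.- x y) h)
      where open ≡-Reasoning

    ∣gap∣ : ∀ {z y} → x y +1 ℚ.< x z → 1ℚ ℚ.< ℚ.∣ x z ℚ.- x y ∣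
    ∣gap∣ {z} {y} h = subst (1ℚ ℚ.<_) (sym (ℚ.0≤p⇒∣p∣≡p (ℚ.<⇒≤ (ℚ.<-trans (ℚ.positive⁻¹ 1ℚ) (gap h))))) (gap h)

    ∣gap∣′ : ∀ {z y} → x y +1 ℚ.< x z → 1ℚ ℚ.< ℚ.∣ x y ℚ.- x z ∣
    ∣gap∣′ {z} {y} h = subst (1ℚ ℚ.<_)
      (trans (sym (ℚ.∣-p∣≡∣p∣ (x z ℚ.- x y))) (cong ℚ.∣_∣ (⁻¹-anti-homo-// ℚ.+-0-group (x z) (x y)))) (∣gap∣ h)

  comparator-far : ∀ {z y} b → x y +1 ℚ.< x z → comparator x z y b ≡ z
  comparator-far {z} {y} b h with 1ℚ ℚ.<? ℚ.∣ x z ℚ.- x y ∣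
  ... | no ¬far = ⊥-elim (¬far (∣gap∣ h))
  ... | yes _ = if-yes (x y ℚ.<? x z) (ℚ.≤-<-trans (p≤p+1 (x y)) h)

  comparator-self : ∀ z b → comparator x z z b ≡ z
  comparator-self z b with 1ℚ ℚ.<? ℚ.∣ x z ℚ.- x z ∣
  ... | yes _ = if-same (does (x z ℚ.<? x z))
  ... | no _  = if-same b

  comparator-sound : ∀ {z y} b → comparator x z y b ≡ z → x y ℚ.≤ x z +1
  comparator-sound {z} {y} b eq = ℚ.≮⇒≥ λ h → far h eq
    where
    far : x z +1 ℚ.< x y → comparator x z y b ≢ z
    far h eq with 1ℚ ℚ.<? ℚ.∣ x z ℚ.- x y ∣
    ... | no ¬far = ¬far (∣gap∣′ h)
    ... | yes _ = <ℚ⇒≱ h (subst (λ i → x i ℚ.≤ x z +1) (sym (trans (sym (if-no (x y ℚ.<? x z) ¬y<z)) eq)) (p≤p+1 (x z)))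
      where
      ¬y<z : ¬ x y ℚ.< x z
      ¬y<z y<z = <ℚ⇒≱ (ℚ.≤-<-trans (p≤p+1 (x z)) h) (ℚ.<⇒≤ y<z)

  module _ (adv : Adversary n) (h : History n) (qs : List (Query n)) where

    answerRound-∈⁺ : ∀ {z y} → (z , y) ∈ qs → ∃ λ b → ((z , y) , comparator x z y b) ∈ answerRound x adv h qs
    answerRound-∈⁺ {z} {y} q∈ = adv h qs k ,
      subst (λ q → (q , comparator x (proj₁ q) (proj₂ q) (adv h qs k)) ∈ answerRound x adv h qs)
            (sym (lookup-index q∈)) (∈-tabulate⁺ k)
      where k = Any.index q∈

    answerRound-∈⁻ : ∀ {z y a} → ((z , y) , a) ∈ answerRound x adv h qs → ∃ λ b → a ≡ comparator x z y b
    answerRound-∈⁻ e∈ with k , refl ← ∈-tabulate⁻ e∈ = adv h qs k , refl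

_answer≟_ : ∀ {n} → DecidableEquality (Query n × Fin n)
_answer≟_ = Product.≡-dec (Product.≡-dec Fin._≟_ Fin._≟_) Fin._≟_

-- Only the query with `z` in first place counts; the adversary may answer `(z , y)` and `(y , z)`
-- differently. A pair that was not asked counts as no win.
beats : ∀ {n} → Round n → Fin n → Fin n → Bool
beats rd z y = does (DecMembership._∈?_ _answer≟_ ((z , y) , z) rd)

beats⁺ : ∀ {n} (rd : Round n) {z y} → ((z , y) , z) ∈ rd → T (beats rd z y)
beats⁺ rd = does⁺ (DecMembership._∈?_ _answer≟_ _ rd)

beats⁻ : ∀ {n} (rd : Round n) {z y} → T (beats rd z y) → ((z , y) , z) ∈ rd
beats⁻ rd = does⁻ (DecMembership._∈?_ _answer≟_ _ rd)

module _ {n : ℕ} where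

  private
    onIndices : ∀ {xs ys : List (Fin n)} (p : xs ↭ ys) → Permutation (length xs) (length ys)
    onIndices p = Homogeneous.onIndices (↭⇒↭ₛ p)

  ordering : ∀ (xs : List (Fin n)) → xs ↭ allFin n → Permutation′ n
  ordering xs p = cast-id (sym len) ∘ₚ (onIndices p ∘ₚ cast-id (length-tabulate (λ i → i)))
    where
    len : length xs ≡ n
    len = trans (↭-length p) (length-tabulate (λ i → i))

  -- The permutation underlying `p` sends a position of `xs` to the position of the same item in
  -- `allFin n`, and there the position is the item.
  ordering-lookup : ∀ xs (p : xs ↭ allFin n) .(eq : n ≡ length xs) i → ordering xs p ⟨$⟩ʳ i ≡ List.lookup xs (Fin.cast eq i)
  ordering-lookup xs p eq i = trans
    (sym (lookup-allFin (onIndices p ⟨$⟩ʳ Fin.cast eq i)))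
    (sym (Permutationₛ.onIndices-lookup (setoid (Fin n)) (↭⇒↭ₛ p) (Fin.cast eq i)))
    where
    len : length (allFin n) ≡ n
    len = length-tabulate (λ i → i)
    lookup-allFin : ∀ k → List.lookup (allFin n) k ≡ Fin.cast len k
    lookup-allFin k = trans (cong (List.lookup (allFin n)) (sym (Fin.cast-involutive (sym len) len k)))
      (lookup-tabulate (λ i → i) (Fin.cast len k))

  AllPairs-lookup : ∀ {R : Fin n → Fin n → Set} {xs} → AllPairs R xs →
                    ∀ {i j} → i Fin.< j → R (List.lookup xs i) (List.lookup xs j)
  AllPairs-lookup (Rx ∷ _)  {zero}  {suc j} _         = All.lookup Rx (∈-lookup j)
  AllPairs-lookup (_ ∷ Rxs) {suc i} {suc j} (s≤s i<j) = AllPairs-lookup Rxs i<j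

  ordering-AllPairs : ∀ {R : Fin n → Fin n → Set} {xs} (p : xs ↭ allFin n) → AllPairs R xs →
                      ∀ {i j} → i Fin.< j → R (ordering xs p ⟨$⟩ʳ i) (ordering xs p ⟨$⟩ʳ j)
  ordering-AllPairs {R} {xs} p Rxs {i} {j} i<j =
    subst₂ R (sym (ordering-lookup xs p len i)) (sym (ordering-lookup xs p len j))
      (AllPairs-lookup Rxs (subst₂ _<_ (sym (Fin.toℕ-cast len i)) (sym (Fin.toℕ-cast len j)) i<j))
    where
    len : n ≡ length xs
    len = sym (trans (↭-length p) (length-tabulate (λ i → i)))

-- Class numbers, union bounds and counting inside a group

-- The value 0 does not entail a · 2⁰ ≤ m.
level : ℕ → ℕ → ℕ → ℕ
level a zero    m = 0
level a (suc k) m = if a * 2 ^ suc k ≤ᵇ m then suc k else level a k m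

level-≤ : ∀ a k m → level a k m ≤ k
level-≤ a zero    m = z≤n
level-≤ a (suc k) m with a * 2 ^ suc k ≤ᵇ m
... | true  = ≤-refl
... | false = m≤n⇒m≤1+n (level-≤ a k m)

level-lower : ∀ a k m {i} → level a k m ≡ suc i → a * 2 ^ suc i ≤ m
level-lower a (suc k) m eq with a * 2 ^ suc k ≤ᵇ m in fits
level-lower a (suc k) m refl | true  = ≤ᵇ⇒≤ _ m (subst T (sym fits) _)
level-lower a (suc k) m eq   | false = level-lower a k m eq

level-upper : ∀ a k m → m < a * 2 ^ suc k → m < a * 2 ^ suc (level a k m)
level-upper a zero    m h = h
level-upper a (suc k) m h with a * 2 ^ suc k ≤ᵇ m in fits
... | true  = h
... | false = level-upper a k m (≰⇒> (λ le → subst T fits (≤⇒≤ᵇ le)))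

-- A single class is trivially balanced, so no slack is allowed at depth 0. The middle pieces are
-- then empty and the group dissolves into singletons.
slack : ℕ → ℕ → ℕ
slack δ zero    = 0
slack δ (suc _) = δ

slack-≤ : ∀ δ j → slack δ j ≤ δ
slack-≤ δ zero    = z≤n
slack-≤ δ (suc _) = ≤-refl

-- The union bound in expectation form: exchange the two sums and bound each term separately.
∑-average : ∀ {A K : Set} (bs : List A) (ks : List K) (f : A → K → ℕ) w (bound : K → ℕ) →
  (∀ {k} → k ∈ ks → ∑ bs (λ b → f b k) * w ≤ bound k) →
  ∑ bs (λ b → ∑ ks (f b)) * w ≤ ∑ ks bound
∑-average bs ks f w bound h = begin
  ∑ bs (λ b → ∑ ks (f b)) * w            ≡⟨ cong (_* w) (∑-swap bs ks f) ⟩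
  ∑ ks (λ k → ∑ bs (λ b → f b k)) * w    ≡⟨ ∑-*ʳ ks _ w ⟨
  ∑ ks (λ k → ∑ bs (λ b → f b k) * w)    ≤⟨ ∑-mono-∈ ks h ⟩
  ∑ ks bound                             ∎
  where open ≤-Reasoning

length-concatMap : ∀ {A B : Set} (f : A → List B) xs → length (concatMap f xs) ≡ ∑ xs (length ∘ f)
length-concatMap f []       = refl
length-concatMap f (x ∷ xs) = trans (length-++ (f x)) (cong (length (f x) +_) (length-concatMap f xs))

length-concat : ∀ {A : Set} (xss : List (List A)) → length (concat xss) ≡ ∑ xss length
length-concat []         = refl
length-concat (xs ∷ xss) = trans (length-++ xs) (cong (length xs +_) (length-concat xss))

elem : ∀ {n} → List (Fin n) → Fin n → Bool
elem g i = any (λ h → does (i Fin.≟ h)) g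

∑-none : ∀ {A : Set} (xs : List A) → ∑ xs (λ _ → 0) ≡ 0
∑-none xs = trans (∑-const xs 0) (*-zeroʳ (length xs))

count-singleton : ∀ {n} (h : Fin n) (p : Fin n → Bool) →
  count (λ i → does (i Fin.≟ h) ∧ p i) (allFin n) ≡ ⟦ p h ⟧
count-singleton {suc n} zero    p = trans (∑-allFin-suc n (λ i → ⟦ does (i Fin.≟ zero) ∧ p i ⟧))
  (trans (cong (⟦ p zero ⟧ +_) (∑-none (allFin n))) (+-identityʳ _))
count-singleton {suc n} (suc h) p =
  trans (∑-allFin-suc n (λ i → ⟦ does (i Fin.≟ suc h) ∧ p i ⟧)) (count-singleton h (λ i → p (suc i)))

-- Carries counts inside a group over to counts over all items, the form in which the tail bound is
-- stated.
count-allFin : ∀ {n} {g : List (Fin n)} → Unique g → ∀ (p : Fin n → Bool) →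
  count (λ i → elem g i ∧ p i) (allFin n) ≡ count p g
count-allFin {n} {[]}    []       p = ∑-none (allFin n)
count-allFin {n} {h ∷ g} (h∉ ∷ u) p = begin
  count (λ i → (does (i Fin.≟ h) ∨ elem g i) ∧ p i) (allFin n)
    ≡⟨ ∑-cong (allFin n) add ⟩
  ∑ (allFin n) (λ i → ⟦ does (i Fin.≟ h) ∧ p i ⟧ + ⟦ elem g i ∧ p i ⟧)
    ≡⟨ ∑-+ (allFin n) _ _ ⟩
  count (λ i → does (i Fin.≟ h) ∧ p i) (allFin n) + count (λ i → elem g i ∧ p i) (allFin n)
    ≡⟨ cong₂ _+_ (count-singleton h p) (count-allFin u p) ⟩
  ⟦ p h ⟧ + count p g ∎
  where
  open ≡-Reasoning
  absent : ∀ {g} → All (h ≢_) g → elem g h ≡ false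
  absent []              = refl
  absent {y ∷ g} (ne ∷ nes) with h Fin.≟ y
  ... | yes eq = ⊥-elim (ne eq)
  ... | no _   = absent nes
  add : ∀ i → ⟦ (does (i Fin.≟ h) ∨ elem g i) ∧ p i ⟧ ≡ ⟦ does (i Fin.≟ h) ∧ p i ⟧ + ⟦ elem g i ∧ p i ⟧
  add i with i Fin.≟ h
  ... | no _ = refl
  ... | yes refl rewrite absent h∉ = sym (+-identityʳ _)

Unique-concat⁻ : ∀ {A : Set} {xss : List (List A)} → Unique (concat xss) → ∀ {xs} → xs ∈ xss → Unique xs
Unique-concat⁻ {xss = xs ∷ xss} u (here refl) = left xs u
  where
  left : ∀ ys → Unique (ys ++ concat xss) → Unique ys
  left []       _        = []
  left (y ∷ ys) (p ∷ ps) = All.++⁻ˡ ys p ∷ left ys ps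
Unique-concat⁻ {xss = ys ∷ xss} u (there xs∈) = Unique-concat⁻ (right ys u) xs∈
  where
  right : ∀ ys → Unique (ys ++ concat xss) → Unique (concat xss)
  right []       u       = u
  right (_ ∷ ys) (_ ∷ u) = right ys u

truncate : ∀ {A : Set} → ℕ → List A → List A
truncate k xs = if length xs ≤ᵇ k then xs else []

length-truncate : ∀ {A : Set} k (xs : List A) → length (truncate k xs) ≤ k
length-truncate k xs with length xs ≤ᵇ k in fits
... | true  = ≤ᵇ⇒≤ (length xs) k (subst T (sym fits) _)
... | false = z≤n

truncate-fits : ∀ {A : Set} k (xs : List A) → length xs ≤ k → truncate k xs ≡ xs
truncate-fits k xs h with length xs ≤ᵇ k | ≤⇒≤ᵇ h
... | true | _ = refl

-- One round on all groups

module Rounds (n L δ : ℕ) where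

  Group : Set
  Group = List (Fin n)

  -- At positive depth the mean class size is at least 4δ, which makes the middle pieces at most
  -- half the group. Maximality of the depth keeps the mean size at most 8δ, which bounds the
  -- comparisons.
  depth loss : Group → ℕ
  depth g = level (4 * δ) L (length g)
  loss  g = slack δ (depth g)

  -- Each item owns `L` random bits per round, of which its group reads a prefix; one bit string
  -- thus serves every possible division into groups.
  col : Bits (n * L) → (g : Group) → Fin n → Bits (depth g)
  col β g z = colour (depth g) (chunk n L β z)

  class : Bits (n * L) → (g : Group) → Bits (depth g) → Group
  class β g = fibre (≡-dec Bool._≟_) (col β g) g

  linked : Bits (n * L) → Group → Fin n → Fin n → Bool
  linked β g z y = (col β g y == col β g z) ∨ (col β g y == Vec.replicate (depth g) false)

  groupQueries : Bits (n * L) → Group → List (Query n)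
  groupQueries β g = concatMap (λ z → map (z ,_) (filterᵇ (linked β g z) g)) g

  -- Exceeded only if some colouring is unbalanced; truncation makes the bound hold for all bits.
  budget : ℕ
  budget = n * (δ * 18)

  roundQueries : Bits (n * L) → List Group → List (Query n)
  roundQueries β gs = truncate budget (concatMap (groupQueries β) gs)

  refine : Bits (n * L) → Round n → Group → List Group
  refine β rd g = Split.refine (loss g) (col β g) (beats rd) g

  step : Bits (n * L) → Round n → List Group → List Group
  step β rd = concatMap (refine β rd)

  concat-step : ∀ β rd gs → concat (step β rd gs) ↭ concat gs
  concat-step β rd gs = ↭-trans (↭-reflexive (concat-concatMap (refine β rd) gs))
    (↭-trans (concatMap-↭ gs (λ g → Split.concat-refine (loss g) (col β g) (beats rd) g))
             (↭-reflexive (cong concat (map-id gs))))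

  -- Middle pieces have at most 2ʲ · 2δ items, half of 4δ · 2ʲ, which is at most the size of the
  -- group by the choice of the depth. No balance is assumed, so sizes halve for all random bits.
  length-step : ∀ r β rd gs → (∀ {g} → g ∈ gs → length g ≤ 2 ^ suc r) →
                ∀ {h} → h ∈ step β rd gs → length h ≤ 2 ^ r
  length-step r β rd gs small h∈ with g , g∈ , h∈g ← ∈-concatMap⁻′ (refine β rd) gs h∈
    with Split.length-refine (loss g) (col β g) (beats rd) g h∈g
  ... | inj₂ h≤1 = ≤-trans h≤1 (m^n>0 2 r)
  ... | inj₁ h≤ = *-cancelˡ-≤ 2 (≤-trans (*-monoʳ-≤ 2 h≤) (≤-trans (half (depth g) refl) (small g∈)))
    where
    half : ∀ j → level (4 * δ) L (length g) ≡ j → 2 * (2 ^ j * (2 * slack δ j)) ≤ length g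
    -- `level-lower` says nothing at depth 0, but there the slack, and with it the left side, is 0.
    half zero    _  = z≤n
    half (suc i) eq = ≤-trans (≤-reflexive (lem (2 ^ suc i) δ)) (level-lower (4 * δ) L (length g) eq)
      where
      lem : ∀ a d → 2 * (a * (2 * d)) ≡ 4 * d * a
      lem = solve-∀

  module _ (x : Fin n → ℚ) where
    open Order x

    -- The constant test controls class sizes and so the number of comparisons; the other two are
    -- the sets whose balance the refinement uses.
    tests : Fin n → List (Fin n → Bool)
    tests w = (λ _ → true) ∷ reachable w ∷ beaten w ∷ []

    Balanced : Bits (n * L) → Group → (Fin n → Bool) → Set
    Balanced β g q = ∀ κ κ′ → count q (class β g κ) ≤ count q (class β g κ′) + loss g

    Good : Bits (n * L) → List Group → Set
    Good β gs = ∀ {g} → g ∈ gs → ∀ {w} → w ∈ g → ∀ {q} → q ∈ tests w → Balanced β g q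

    unbalanced : Bits (n * L) → Group → (Fin n → Bool) → ℕ
    unbalanced β g q = ∑ (allBits (depth g)) λ κ → ∑ (allBits (depth g)) λ κ′ →
      ⟦ count q (class β g κ′) + loss g <ᵇ count q (class β g κ) ⟧

    -- Counts all violations of balance rather than merely detecting one: the expectation of a count
    -- is a sum of probabilities, as the union bound requires.
    failures : Bits (n * L) → List Group → ℕ
    failures β gs = ∑ gs λ g → ∑ g λ w → ∑ (tests w) (unbalanced β g)

    failures⇒Good : ∀ β gs → failures β gs ≡ 0 → Good β gs
    failures⇒Good β gs none {g} g∈ {w} w∈ {q} q∈ κ κ′ = ≮⇒≥ λ lt →
      n≮0 (subst (1 ≤_) none (≤-trans (≤-trans (⟦⟧-mono {true} (λ _ → <⇒<ᵇ lt))
        (∑-∈ (λ κ′ → ⟦ count q (class β g κ′) + loss g <ᵇ count q (class β g κ) ⟧) (∈-allBits κ′)))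
        (≤-trans (∑-∈ (λ κ → ∑ (allBits (depth g)) λ κ′ → ⟦ count q (class β g κ′) + loss g <ᵇ count q (class β g κ) ⟧) (∈-allBits κ))
        (≤-trans (∑-∈ (unbalanced β g) q∈)
        (≤-trans (∑-∈ (λ w → ∑ (tests w) (unbalanced β g)) w∈)
                 (∑-∈ (λ g → ∑ g λ w → ∑ (tests w) (unbalanced β g)) g∈))))))

    module _ (n<2^1+L : n < 2 ^ suc L) (c : ℕ) (δ≡23c : δ ≡ 23 * c) (δ≥1 : 1 ≤ δ) where

      -- The cap `L` on the depth does no harm: n < 2^(1 + L) and δ ≥ 1 put every group below 4δ ·
      -- 2^(1 + L), the hypothesis of `level-upper`.
      length-upper : ∀ g → length g ≤ n → length g ≤ 8 * δ * 2 ^ depth g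
      length-upper g g≤n = ≤-trans (<⇒≤ (level-upper (4 * δ) L (length g) (begin-strict
        length g              ≤⟨ g≤n ⟩
        n                     <⟨ n<2^1+L ⟩
        2 ^ suc L             ≡⟨ *-identityˡ _ ⟨
        1 * 2 ^ suc L         ≤⟨ *-monoˡ-≤ (2 ^ suc L) (≤-trans δ≥1 (m≤n*m δ 4)) ⟩
        4 * δ * 2 ^ suc L     ∎))) (≤-reflexive (lem δ (2 ^ depth g)))
        where
        open ≤-Reasoning
        lem : ∀ d a → 4 * d * (2 * a) ≡ 8 * d * a
        lem = solve-∀

      -- There are at most 2ᴸ · 2ᴸ pairs of colours, each violating balance with probability at most
      -- 1/2ᶜ.
      unbalanced-bound : ∀ g → Unique g → length g ≤ n → ∀ q →
        ∑ (allBits (n * L)) (λ β → unbalanced β g q) * 2 ^ c ≤ 2 ^ L * (2 ^ L * 2 ^ (n * L))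
      unbalanced-bound g u g≤n q = begin
        ∑ (allBits (n * L)) (λ β → unbalanced β g q) * 2 ^ c
          ≤⟨ ∑-average (allBits (n * L)) (allBits j) _ (2 ^ c) (λ _ → 2 ^ j * 2 ^ (n * L)) (λ {κ} _ →
               ≤-trans (∑-average (allBits (n * L)) (allBits j) _ (2 ^ c) (λ _ → 2 ^ (n * L)) (λ {κ′} _ → pair κ κ′))
                 (≤-reflexive (trans (∑-const (allBits j) _) (cong (_* 2 ^ (n * L)) (length-allBits j))))) ⟩
        ∑ (allBits j) (λ _ → 2 ^ j * 2 ^ (n * L))
          ≡⟨ trans (∑-const (allBits j) _) (cong (_* (2 ^ j * 2 ^ (n * L))) (length-allBits j)) ⟩
        2 ^ j * (2 ^ j * 2 ^ (n * L))
          ≤⟨ *-mono-≤ 2^j≤ (*-monoˡ-≤ (2 ^ (n * L)) 2^j≤) ⟩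
        2 ^ L * (2 ^ L * 2 ^ (n * L)) ∎
        where
        open ≤-Reasoning
        j = depth g
        j≤L : j ≤ L
        j≤L = level-≤ (4 * δ) L (length g)
        2^j≤ : 2 ^ j ≤ 2 ^ L
        2^j≤ = ^-monoʳ-≤ 2 j≤L
        q′ : Fin n → Bool
        q′ i = elem g i ∧ q i
        size : ∀ β κ → count q (class β g κ) ≡ classSize {n} {L} j q′ κ β
        size β κ = trans (count-filterᵇ q _ g) (trans (sym (count-allFin u _))
          (∑-cong (allFin n) (λ i → cong ⟦_⟧ (trans (cong (elem g i ∧_) (Bool.∧-comm (col β g i == κ) (q i)))
                                                    (sym (Bool.∧-assoc (elem g i) (q i) (col β g i == κ)))))))
        pair : ∀ κ κ′ → ∑ (allBits (n * L)) (λ β → ⟦ count q (class β g κ′) + loss g <ᵇ count q (class β g κ) ⟧) * 2 ^ c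
               ≤ 2 ^ (n * L)
        pair κ κ′ = by-depth j refl
          where
          irrelevant : ∀ {j} → j ≡ 0 → (u v : Bits j) → u ≡ v
          irrelevant refl [] [] = refl
          never : ∀ a b → ⟦ a + b <ᵇ a ⟧ ≤ 0
          never a b = ⟦⟧-mono {b = false} (λ t → <⇒≱ (<ᵇ⇒< (a + b) a t) (m≤m+n a b))
          by-depth : ∀ i → j ≡ i →
            ∑ (allBits (n * L)) (λ β → ⟦ count q (class β g κ′) + loss g <ᵇ count q (class β g κ) ⟧) * 2 ^ c ≤ 2 ^ (n * L)
          -- At depth 0 the two colours coincide, so a violation is impossible even without slack.
          by-depth zero eq rewrite irrelevant eq κ κ′ = ≤-trans (*-monoˡ-≤ (2 ^ c)
            (≤-trans (∑-mono (allBits (n * L)) (λ β → never (count q (class β g κ′)) (loss g)))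
                     (≤-reflexive (∑-none (allBits (n * L)))))) z≤n
          by-depth (suc i) eq = begin
            ∑ (allBits (n * L)) (λ β → ⟦ count q (class β g κ′) + loss g <ᵇ count q (class β g κ) ⟧) * 2 ^ c
              ≡⟨ cong (_* 2 ^ c) (∑-cong (allBits (n * L)) (λ β → cong₂ (λ s t → ⟦ s <ᵇ t ⟧)
                   (cong₂ _+_ (size β κ′) (trans (cong (slack δ) eq) δ≡23c)) (size β κ))) ⟩
            ∑ (allBits (n * L)) (λ β → ⟦ classSize {n} {L} j q′ κ′ β + 23 * c <ᵇ classSize {n} {L} j q′ κ β ⟧) * 2 ^ c
              ≤⟨ tail-bound {n} {L} j≤L q′ κ κ′ c few ⟩
            2 ^ (n * L) ∎
            where
            few : count q′ (allFin n) ≤ 8 * (23 * c) * 2 ^ j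
            few = subst (λ δ → count q′ (allFin n) ≤ 8 * δ * 2 ^ j) δ≡23c
              (≤-trans (≤-reflexive (count-allFin u q)) (≤-trans (count-≤-length q g) (length-upper g g≤n)))

      module _ (gs : List Group) (p : concat gs ↭ allFin n) where

        total-length : ∑ gs length ≡ n
        total-length = trans (sym (length-concat gs)) (trans (↭-length p) (length-tabulate (λ i → i)))

        length-≤n : ∀ {g} → g ∈ gs → length g ≤ n
        length-≤n g∈ = ≤-trans (∑-∈ length g∈) (≤-reflexive total-length)

        Unique-group : ∀ {g} → g ∈ gs → Unique g
        Unique-group = Unique-concat⁻ (Permutationₛ.Unique-resp-↭ (setoid (Fin n)) (↭⇒↭ₛ (↭-sym p)) (Unique.allFin⁺ n))

        -- The groups partition the `n` items, so there are `n` choices of `w`, three tests for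
        -- each, and the pairs of colours counted in `unbalanced-bound`.
        failures-bound : ∑ (allBits (n * L)) (λ β → failures β gs) * 2 ^ c ≤ n * (3 * (2 ^ L * (2 ^ L * 2 ^ (n * L))))
        failures-bound = begin
          ∑ (allBits (n * L)) (λ β → failures β gs) * 2 ^ c
            ≤⟨ ∑-average (allBits (n * L)) gs (λ β g → ∑ g λ w → ∑ (tests w) (unbalanced β g)) (2 ^ c)
                 (λ g → length g * (3 * K)) per-group ⟩
          ∑ gs (λ g → length g * (3 * K))
            ≡⟨ ∑-*ʳ gs length (3 * K) ⟩
          ∑ gs length * (3 * K)
            ≡⟨ cong (_* (3 * K)) total-length ⟩
          n * (3 * K) ∎
          where
          open ≤-Reasoning
          K = 2 ^ L * (2 ^ L * 2 ^ (n * L))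
          per-group : ∀ {g} → g ∈ gs → ∑ (allBits (n * L)) (λ β → ∑ g λ w → ∑ (tests w) (unbalanced β g)) * 2 ^ c
                               ≤ length g * (3 * K)
          per-group {g} g∈ = ≤-trans
            (∑-average (allBits (n * L)) g (λ β w → ∑ (tests w) (unbalanced β g)) (2 ^ c) (λ _ → 3 * K) λ {w} _ →
              ∑-average (allBits (n * L)) (tests w) (λ β → unbalanced β g) (2 ^ c) (λ _ → K) λ {q} _ →
                unbalanced-bound g (Unique-group g∈) (length-≤n g∈) q)
            (≤-reflexive (∑-const g (3 * K)))

        module _ (β : Bits (n * L)) (good : Good β gs) where

          -- Balance of the constant test, summed over all classes κ′, compares M copies of one
          -- class with the whole group: M · |class| ≤ |g| + Mδ ≤ 9δM.
          length-class : ∀ {g z} → g ∈ gs → z ∈ g → ∀ κ → length (class β g κ) ≤ δ * 9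
          length-class {g} {z} g∈ z∈ κ = *-cancelˡ-≤ M (begin
            M * length (class β g κ)
              ≡⟨ trans (∑-const (allBits (depth g)) _) (cong (_* length (class β g κ)) (length-allBits (depth g))) ⟨
            ∑ (allBits (depth g)) (λ _ → length (class β g κ))
              ≤⟨ ∑-mono (allBits (depth g)) (λ κ′ → subst₂ (λ a b → a ≤ b + loss g) (count-true (class β g κ))
                   (count-true (class β g κ′)) (good g∈ z∈ (here refl) κ κ′)) ⟩
            ∑ (allBits (depth g)) (λ κ′ → length (class β g κ′) + loss g)
              ≡⟨ ∑-+ (allBits (depth g)) _ _ ⟩
            ∑ (allBits (depth g)) (λ κ′ → length (class β g κ′)) + ∑ (allBits (depth g)) (λ _ → loss g)
              ≡⟨ cong₂ _+_ whole (trans (∑-const (allBits (depth g)) _) (cong (_* loss g) (length-allBits (depth g)))) ⟩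
            length g + M * loss g
              ≤⟨ +-mono-≤ (length-upper g (length-≤n g∈)) (*-monoʳ-≤ M (slack-≤ δ (depth g))) ⟩
            8 * δ * M + M * δ
              ≡⟨ lem δ M ⟩
            M * (δ * 9) ∎)
            where
            open ≤-Reasoning
            M = 2 ^ depth g
            instance _ = m^n≢0 2 (depth g)
            lem : ∀ d m → 8 * d * m + m * d ≡ m * (d * 9)
            lem = solve-∀
            count-true : ∀ {A : Set} (xs : List A) → count (λ _ → true) xs ≡ length xs
            count-true xs = trans (∑-const xs 1) (*-identityʳ _)
            whole : ∑ (allBits (depth g)) (λ κ′ → length (class β g κ′)) ≡ length g
            whole = trans (sym (length-concatMap (class β g) (allBits (depth g))))
              (↭-length (concatMap-fibre (≡-dec Bool._≟_) (col β g) g (Unique-allBits (depth g)) (λ _ → ∈-allBits _)))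

          length-queries : length (concatMap (groupQueries β) gs) ≤ budget
          length-queries = begin
            length (concatMap (groupQueries β) gs)      ≡⟨ length-concatMap (groupQueries β) gs ⟩
            ∑ gs (λ g → length (groupQueries β g))      ≤⟨ ∑-mono-∈ gs (λ {g} g∈ → length-concatMap-≤ g (per-item g∈)) ⟩
            ∑ gs (λ g → length g * (δ * 18))            ≡⟨ ∑-*ʳ gs length (δ * 18) ⟩
            ∑ gs length * (δ * 18)                      ≡⟨ cong (_* (δ * 18)) total-length ⟩
            budget                                      ∎
            where
            open ≤-Reasoning
            either : ∀ a b → ⟦ a ∨ b ⟧ ≤ ⟦ a ⟧ + ⟦ b ⟧
            either true  b = s≤s z≤n
            either false b = ≤-refl
            per-item : ∀ {g} → g ∈ gs → ∀ {z} → z ∈ g → length (map (z ,_) (filterᵇ (linked β g z) g)) ≤ δ * 18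
            per-item {g} g∈ {z} z∈ = begin
              length (map (z ,_) (filterᵇ (linked β g z) g))
                ≡⟨ trans (length-map (z ,_) (filterᵇ (linked β g z) g)) (length-filterᵇ (linked β g z) g) ⟩
              count (linked β g z) g
                ≤⟨ ∑-mono g (λ y → either (col β g y == col β g z) _) ⟩
              ∑ g (λ y → ⟦ col β g y == col β g z ⟧ + ⟦ col β g y == Vec.replicate (depth g) false ⟧)
                ≡⟨ ∑-+ g _ _ ⟩
              count (λ y → col β g y == col β g z) g + count (λ y → col β g y == Vec.replicate (depth g) false) g
                ≡⟨ cong₂ _+_ (length-filterᵇ (λ y → col β g y == col β g z) g)
                           (length-filterᵇ (λ y → col β g y == Vec.replicate (depth g) false) g) ⟨
              length (class β g (col β g z)) + length (class β g (Vec.replicate (depth g) false))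
                ≤⟨ +-mono-≤ (length-class g∈ z∈ _) (length-class g∈ z∈ _) ⟩
              δ * 9 + δ * 9
                ≡⟨ *-distribˡ-+ δ 9 9 ⟨
              δ * 18 ∎

          -- Under balance each item is compared with at most two classes of at most 9δ items, so
          -- the queries fit the budget and truncation leaves them intact.
          asked : ∀ {g z y} → g ∈ gs → z ∈ g → y ∈ g → T (linked β g z y) → (z , y) ∈ roundQueries β gs
          asked {g} {z} {y} g∈ z∈ y∈ t = subst ((z , y) ∈_) (sym (truncate-fits budget _ length-queries))
            (∈-concatMap⁺ (groupQueries β) (Any.map (λ { refl →
              ∈-concatMap⁺ (λ z → map (z ,_) (filterᵇ (linked β g z) g)) (Any.map (λ { refl →
                ∈-map⁺ (z ,_) (∈-filterᵇ⁺ (linked β g z) y∈ t) }) z∈) }) g∈))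

          module _ (adv : Adversary n) (h : History n) where

            private
              rd = answerRound x adv h (roundQueries β gs)

            beats-sound : ∀ {z y} → T (beats rd z y) → x y ℚ.≤ x z +1
            beats-sound t with b , eq ← answerRound-∈⁻ x adv h (roundQueries β gs) (beats⁻ rd t) = comparator-sound x b (sym eq)

            answered : ∀ {z y} → (z , y) ∈ roundQueries β gs → (∀ b → comparator x z y b ≡ z) → T (beats rd z y)
            answered {z} {y} q∈ eq with b , e∈ ← answerRound-∈⁺ x adv h (roundQueries β gs) q∈ =
              beats⁺ rd (subst (λ a → ((z , y) , a) ∈ rd) (eq b) e∈)

            -- Pieces of different groups inherit the order of their groups, since refinement only
            -- subdivides; pieces of one group are ordered by `refine-AllPairs`.
            step-AllPairs : AllPairs _≼_ gs → AllPairs _≼_ (step β rd gs)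
            step-AllPairs ordered = AllPairs.concat⁺
              (All.map⁺ (All.tabulate λ {g} g∈ → SplitCorrect.refine-AllPairs (loss g) (col β g) (beats rd) g x
                beats-sound
                (λ z∈ y∈ c far → answered (asked g∈ z∈ y∈ (same-class {g} c)) (λ b → comparator-far x b far))
                (λ z∈ → answered (asked g∈ z∈ z∈ (same-class {g} (inj₁ refl))) (comparator-self x _))
                (λ w∈ → good g∈ w∈ (there (here refl)) , good g∈ w∈ (there (there (here refl))))))
              (AllPairs.map⁺ (AllPairs.map (λ g≼g′ → All.tabulate λ h∈ → All.tabulate λ h′∈ {_} {_} u∈ z∈ →
                g≼g′ (within h∈ u∈) (within h′∈ z∈)) ordered))
              where
              within : ∀ {g h z} → h ∈ refine β rd g → z ∈ h → z ∈ g
              within {g} h∈ z∈ = ∈-resp-↭ (Split.concat-refine (loss g) (col β g) (beats rd) g) (∈-concat⁺′ z∈ h∈)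
              same-class : ∀ {g z y} → col β g y ≡ col β g z ⊎ col β g y ≡ Vec.replicate (depth g) false → T (linked β g z y)
              same-class {g} (inj₁ eq) = Equivalence.from T-∨ (inj₁ (does⁺ (≡-dec Bool._≟_ _ _) eq))
              same-class {g} (inj₂ eq) = Equivalence.from T-∨ (inj₂ (does⁺ (≡-dec Bool._≟_ _ _) eq))

-- Several rounds

Near⇒≥[4] : ∀ {p q} → p ℚ.≤ q +1 +1 +1 +1 → q ≥[ (ℤ.+ 4) ℚ./ 1 ] p
Near⇒≥[4] {p} {q} h = ℚ.≤-trans (ℚ.+-monoˡ-≤ (ℚ.- ((ℤ.+ 4) ℚ./ 1)) h) (ℚ.≤-reflexive (begin
  q +1 +1 +1 +1 ℚ.+ -4ℚ               ≡⟨ ℚ.+-assoc (q +1 +1 +1) 1ℚ -4ℚ ⟩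
  q +1 +1 +1 ℚ.+ (1ℚ ℚ.+ -4ℚ)         ≡⟨ ℚ.+-assoc (q +1 +1) 1ℚ _ ⟩
  q +1 +1 ℚ.+ (1ℚ ℚ.+ (1ℚ ℚ.+ -4ℚ))   ≡⟨ ℚ.+-assoc (q +1) 1ℚ _ ⟩
  -- After the last reassociation the closed rational to the right of `q` evaluates to `0ℚ`.
  q +1 ℚ.+ (1ℚ ℚ.+ (1ℚ ℚ.+ (1ℚ ℚ.+ -4ℚ)))   ≡⟨ ℚ.+-assoc q 1ℚ _ ⟩
  q ℚ.+ ℚ.0ℚ                          ≡⟨ ℚ.+-identityʳ q ⟩
  q                                   ∎))
  where
  open ≡-Reasoning
  -4ℚ = ℚ.- ((ℤ.+ 4) ℚ./ 1)

not-does : ∀ {P : Set} (P? : Dec P) → P → ⟦ not (does P?) ⟧ ≡ 0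
not-does (yes _) p = refl
not-does (no ¬p) p = ⊥-elim (¬p p)

length-filter-∑ : ∀ {A : Set} {P : A → Set} (P? : ∀ a → Dec (P a)) xs →
  length (List.filter P? xs) ≡ ∑ xs (λ a → ⟦ does (P? a) ⟧)
length-filter-∑ P? []       = refl
length-filter-∑ P? (a ∷ xs) with does (P? a)
... | true  = cong suc (length-filter-∑ P? xs)
... | false = length-filter-∑ P? xs

-- Rounds with fresh random bits each, for a state that only the answers of the round change.
module Strategy {n B : ℕ} {State : Set} (initial : State)
  (ask : Bits B → State → List (Query n)) (advance : Bits B → Round n → State → State)
  (sorting : State → Permutation′ n) where

  -- An `Algorithm` has no memory, so the state is recomputed from the history, with one block of
  -- `B` bits for each past round.
  next : ∀ r → Bits (r * B) → State → History n → List (Query n)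
  next zero    ρ s h        = []
  next (suc r) ρ s []       = ask (Vec.take B ρ) s
  next (suc r) ρ s (rd ∷ h) = next r (Vec.drop B ρ) (advance (Vec.take B ρ) rd s) h

  replay : ∀ r → Bits (r * B) → State → History n → State
  replay zero    ρ s h        = s
  replay (suc r) ρ s []       = s
  replay (suc r) ρ s (rd ∷ h) = replay r (Vec.drop B ρ) (advance (Vec.take B ρ) rd s) h

  algorithm : ℕ → Algorithm n
  algorithm R = record
    { rbits   = R * B
    ; rounds  = R
    ; queries = λ ρ h → next R ρ initial h
    ; output  = λ ρ h → sorting (replay R ρ initial h)
    }

  module _ (x : Fin n → ℚ) (adv : Adversary n) where

    answers : Bits B → History n → State → Round n
    answers β h s = answerRound x adv h (ask β s)

    play : ∀ r → Bits (r * B) → History n → State → State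
    play zero    ρ h s = s
    play (suc r) ρ h s = play r (Vec.drop B ρ) (h ++ [ answers (Vec.take B ρ) h s ])
                                (advance (Vec.take B ρ) (answers (Vec.take B ρ) h s) s)

    module _ (R : ℕ) (ρ : Bits (R * B)) where

      run : ℕ → History n → History n
      run = runFrom (algorithm R) x adv ρ

      -- The two hypotheses say that reading `h` brings the replay to state `s` with bits ρ′ left.
      -- They survive one more round, so the memoryless algorithm agrees with the direct execution
      -- `play`.
      replay-run : ∀ r ρ′ h s →
        (∀ h′ → next R ρ initial (h ++ h′) ≡ next r ρ′ s h′) →
        (∀ h′ → replay R ρ initial (h ++ h′) ≡ replay r ρ′ s h′) →
        replay R ρ initial (run r h) ≡ play r ρ′ h s
      replay-run zero    ρ′ h s eq₁ eq₂ = trans (cong (replay R ρ initial) (sym (++-identityʳ h))) (eq₂ [])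
      replay-run (suc r) ρ′ h s eq₁ eq₂ =
        trans (cong (λ qs → replay R ρ initial (run r (h ++ [ answerRound x adv h qs ]))) asks)
          (replay-run r (Vec.drop B ρ′) (h ++ [ rd ]) (advance (Vec.take B ρ′) rd s)
            (λ h′ → trans (cong (next R ρ initial) (++-assoc h [ rd ] h′)) (eq₁ (rd ∷ h′)))
            (λ h′ → trans (cong (replay R ρ initial) (++-assoc h [ rd ] h′)) (eq₂ (rd ∷ h′))))
        where
        rd = answers (Vec.take B ρ′) h s
        asks : next R ρ initial h ≡ ask (Vec.take B ρ′) s
        asks = trans (cong (next R ρ initial) (sym (++-identityʳ h))) (eq₁ [])

      result-play : result (algorithm R) x adv ρ ≡ sorting (play R ρ [] initial)
      result-play = cong sorting (replay-run R ρ [] initial (λ _ → refl) (λ _ → refl))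

      length-run : ∀ r h → length (run r h) ≡ r + length h
      length-run zero    h = refl
      length-run (suc r) h = trans (length-run r _)
        (trans (cong (r +_) (trans (length-++ h) (+-comm (length h) 1))) (+-suc r (length h)))

      numRounds-≤ : numRounds (finalHistory (algorithm R) x adv ρ) ≤ R
      numRounds-≤ = ≤-trans (length-filter _ (finalHistory (algorithm R) x adv ρ))
        (≤-reflexive (trans (length-run R []) (+-identityʳ R)))

      module _ {b : ℕ} (length-ask : ∀ β s → length (ask β s) ≤ b) where

        length-next : ∀ r ρ s h → length (next r ρ s h) ≤ b
        length-next zero    ρ s h        = z≤n
        length-next (suc r) ρ s []       = length-ask (Vec.take B ρ) s
        length-next (suc r) ρ s (rd ∷ h) = length-next r (Vec.drop B ρ) (advance (Vec.take B ρ) rd s) h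

        numComparisons-run : ∀ r h → numComparisons (run r h) ≤ numComparisons h + r * b
        numComparisons-run zero    h = m≤m+n _ 0
        numComparisons-run (suc r) h = begin
          numComparisons (run r (h ++ [ rd ]))            ≤⟨ numComparisons-run r (h ++ [ rd ]) ⟩
          numComparisons (h ++ [ rd ]) + r * b            ≡⟨ cong (_+ r * b) (∑-++ h [ rd ] length) ⟩
          numComparisons h + (length rd + 0) + r * b      ≤⟨ +-monoˡ-≤ (r * b) (+-monoʳ-≤ (numComparisons h) small) ⟩
          numComparisons h + b + r * b                    ≡⟨ +-assoc (numComparisons h) b (r * b) ⟩
          numComparisons h + suc r * b                    ∎
          where
          open ≤-Reasoning
          rd = answerRound x adv h (next R ρ initial h)
          small : length rd + 0 ≤ b
          small = ≤-trans (≤-reflexive (trans (+-identityʳ _) (length-tabulate _))) (length-next R ρ initial h)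

        numComparisons-≤ : numComparisons (finalHistory (algorithm R) x adv ρ) ≤ R * b
        numComparisons-≤ = numComparisons-run R []

    module _ {P : Permutation′ n → Set} (P? : ∀ y → Dec (P y)) where

      bad : State → ℕ
      bad s = ⟦ not (does (P? (sorting s))) ⟧

      bad-≤1 : ∀ s → bad s ≤ 1
      bad-≤1 s = ⟦⟧-mono {b = true} (λ _ → _)

      good+bad : ∀ R → countGood (λ ρ → P? (result (algorithm R) x adv ρ))
                       + ∑ (allBits (R * B)) (λ ρ → bad (play R ρ [] initial)) ≡ 2 ^ (R * B)
      good+bad R = begin
        countGood (λ ρ → P? (result (algorithm R) x adv ρ)) + bads
          ≡⟨ cong (_+ bads) (length-filter-∑ (λ ρ → P? (result (algorithm R) x adv ρ)) (allBits (R * B))) ⟩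
        ∑ (allBits (R * B)) (λ ρ → ⟦ does (P? (result (algorithm R) x adv ρ)) ⟧) + bads
          ≡⟨ ∑-+ (allBits (R * B)) _ _ ⟨
        ∑ (allBits (R * B)) (λ ρ → ⟦ does (P? (result (algorithm R) x adv ρ)) ⟧ + bad (play R ρ [] initial))
          ≡⟨ ∑-cong (allBits (R * B)) (λ ρ → trans
               (cong (λ y → ⟦ does (P? y) ⟧ + bad (play R ρ [] initial)) (result-play R ρ))
               (complement (does (P? (sorting (play R ρ [] initial)))))) ⟩
        ∑ (allBits (R * B)) (λ _ → 1)
          ≡⟨ trans (∑-const (allBits (R * B)) 1) (trans (*-identityʳ _) (length-allBits (R * B))) ⟩
        2 ^ (R * B) ∎
        where
        open ≡-Reasoning
        bads = ∑ (allBits (R * B)) (λ ρ → bad (play R ρ [] initial))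
        complement : ∀ b → ⟦ b ⟧ + ⟦ not b ⟧ ≡ 1
        complement true  = refl
        complement false = refl

      -- The index of `Inv` is the number of rounds still to come; `K / w` bounds the expected
      -- number of failures in one round.
      module _ (Inv : ℕ → State → Set) (failures : Bits B → State → ℕ) (w K : ℕ)
        (rare      : ∀ {r s} → Inv (suc r) s → ∑ (allBits B) (λ β → failures β s) * w ≤ K * 2 ^ B)
        (preserved : ∀ {r s} β h → Inv (suc r) s → failures β s ≡ 0 → Inv r (advance β (answers β h s) s))
        (settled   : ∀ {s} → Inv 0 s → P (sorting s))
        where

        -- Split on the first block of bits. History and state are fixed before it is drawn, so
        -- `rare` applies against an adaptive adversary. Without failures the induction hypothesis
        -- takes over; otherwise the probability of a bad outcome is at most 1, hence at most the
        -- number of failures.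
        bad-bound : ∀ r h s → Inv r s → ∑ (allBits (r * B)) (λ ρ → bad (play r ρ h s)) * w ≤ r * K * 2 ^ (r * B)
        bad-bound zero    h s inv =
          ≤-trans (≤-reflexive (cong (λ t → (t + 0) * w) (not-does (P? (sorting s)) (settled inv)))) z≤n
        bad-bound (suc r) h s inv = begin
          ∑ (allBits (B + r * B)) (λ ρ → bad (play (suc r) ρ h s)) * w
            ≡⟨ cong (_* w) (trans (∑-allBits-+ B (r * B) (λ ρ → bad (play (suc r) ρ h s)))
                 (∑-cong (allBits B) λ a → ∑-cong (allBits (r * B)) λ b →
                   cong₂ (λ a b → bad (play r b (h ++ [ answers a h s ]) (advance a (answers a h s) s)))
                         (take-++ B a b) (drop-++ B a b))) ⟩
          ∑ (allBits B) inner * w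
            ≡⟨ ∑-*ʳ (allBits B) inner w ⟨
          ∑ (allBits B) (λ a → inner a * w)
            ≤⟨ ∑-mono (allBits B) (λ a → per-block a (failures a s) refl) ⟩
          ∑ (allBits B) (λ a → r * K * N + failures a s * (w * N))
            ≡⟨ ∑-+ (allBits B) _ _ ⟩
          ∑ (allBits B) (λ _ → r * K * N) + ∑ (allBits B) (λ a → failures a s * (w * N))
            ≡⟨ cong₂ _+_ (trans (∑-const (allBits B) (r * K * N)) (cong (_* (r * K * N)) (length-allBits B)))
                 (trans (∑-*ʳ (allBits B) (λ a → failures a s) (w * N)) (sym (*-assoc (∑ (allBits B) (λ a → failures a s)) w N))) ⟩
          2 ^ B * (r * K * N) + ∑ (allBits B) (λ a → failures a s) * w * N
            ≤⟨ +-monoʳ-≤ (2 ^ B * (r * K * N)) (*-monoˡ-≤ N (rare inv)) ⟩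
          2 ^ B * (r * K * N) + K * 2 ^ B * N
            ≡⟨ lem (2 ^ B) r K N ⟩
          suc r * K * (2 ^ B * N)
            ≡⟨ cong (suc r * K *_) (^-distribˡ-+-* 2 B (r * B)) ⟨
          suc r * K * 2 ^ (B + r * B) ∎
          where
          open ≤-Reasoning
          N = 2 ^ (r * B)
          inner : Bits B → ℕ
          inner a = ∑ (allBits (r * B)) (λ b → bad (play r b (h ++ [ answers a h s ]) (advance a (answers a h s) s)))
          lem : ∀ b r k m → b * (r * k * m) + k * b * m ≡ suc r * k * (b * m)
          lem = solve-∀
          per-block : ∀ a k → failures a s ≡ k → inner a * w ≤ r * K * N + k * (w * N)
          per-block a zero    eq = ≤-trans (bad-bound r _ _ (preserved a h inv eq)) (m≤m+n _ _)
          per-block a (suc k) eq = begin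
            inner a * w                         ≤⟨ *-monoˡ-≤ w (∑-mono (allBits (r * B)) (λ b → bad-≤1 _)) ⟩
            ∑ (allBits (r * B)) (λ _ → 1) * w   ≡⟨ cong (_* w) (trans (∑-const (allBits (r * B)) 1)
                                                     (trans (*-identityʳ _) (length-allBits (r * B)))) ⟩
            N * w                               ≡⟨ *-comm N w ⟩
            w * N                               ≤⟨ m≤m+n _ _ ⟩
            suc k * (w * N)                     ≤⟨ m≤n+m _ (r * K * N) ⟩
            r * K * N + suc k * (w * N)         ∎

module Sorter (n L δ : ℕ) where
  open Rounds n L δ

  State : Set
  State = Σ (List Group) λ gs → concat gs ↭ allFin n

  initial : State
  initial = [ allFin n ] , ↭-reflexive (++-identityʳ (allFin n))

  ask : Bits (n * L) → State → List (Query n)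
  ask β (gs , _) = roundQueries β gs

  advance : Bits (n * L) → Round n → State → State
  advance β rd (gs , p) = step β rd gs , ↭-trans (concat-step β rd gs) p

  sorting : State → Permutation′ n
  sorting (gs , p) = ordering (concat gs) p

  open Strategy initial ask advance sorting public

  length-ask : ∀ β s → length (ask β s) ≤ budget
  length-ask β (gs , _) = length-truncate budget (concatMap (groupQueries β) gs)

  module _ (x : Fin n → ℚ) (adv : Adversary n) where
    open Order x

    -- Group sizes halve in each round, so with no rounds left all groups have at most one item and
    -- the order of groups is an order of items.
    Inv : ℕ → State → Set
    Inv r (gs , _) = AllPairs _≼_ gs × (∀ {g} → g ∈ gs → length g ≤ 2 ^ r)

    settled : ∀ {s} → Inv 0 s → IsApproxSorting ((ℤ.+ 4) ℚ./ 1) x (sorting s)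
    settled {gs , p} (ordered , small) i j i<j = Near⇒≥[4] (ordering-AllPairs {R = Near} p near i<j)
      where
      trivial : ∀ g → length g ≤ 1 → AllPairs Near g
      trivial []          _         = []
      trivial (_ ∷ [])    _         = [] ∷ []
      trivial (_ ∷ _ ∷ _) (s≤s ())
      near : AllPairs Near (concat gs)
      near = AllPairs.concat⁺ (All.tabulate (λ g∈ → trivial _ (small g∈)))
        (AllPairs.map (λ g≼h → All.tabulate λ u∈ → All.tabulate λ z∈ → g≼h u∈ z∈) ordered)

    outcome-bound : ∀ R c → n < 2 ^ suc L → n ≤ 2 ^ R → δ ≡ 23 * c → 1 ≤ δ →
      ∑ (allBits (R * (n * L))) (λ ρ → bad x adv (isApproxSorting? ((ℤ.+ 4) ℚ./ 1) x) (play x adv R ρ [] initial)) * 2 ^ c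
      ≤ R * (n * (3 * (2 ^ L * 2 ^ L))) * 2 ^ (R * (n * L))
    outcome-bound R c n<2^1+L n≤2^R δ≡23c δ≥1 = bad-bound x adv (isApproxSorting? ((ℤ.+ 4) ℚ./ 1) x)
      Inv (λ β s → failures x β (proj₁ s)) (2 ^ c) (n * (3 * (2 ^ L * 2 ^ L)))
      (λ {r} {s} _ → ≤-trans (failures-bound x n<2^1+L c δ≡23c δ≥1 (proj₁ s) (proj₂ s)) (≤-reflexive (lem n (2 ^ L) (2 ^ (n * L)))))
      (λ {r} {s} β h inv none →
        step-AllPairs x n<2^1+L c δ≡23c δ≥1 (proj₁ s) (proj₂ s) β (failures⇒Good x β (proj₁ s) none) adv h (proj₁ inv) ,
        length-step r β (answers x adv β h s) (proj₁ s) (proj₂ inv))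
      (λ {s} → settled {s})
      R [] initial
      (([] ∷ []) , λ { (here refl) → ≤-trans (≤-reflexive (length-tabulate (λ i → i))) n≤2^R })
      where
      lem : ∀ n l m → n * (3 * (l * (l * m))) ≡ n * (3 * (l * l)) * m
      lem = solve-∀

-- Choice of the parameters

log₂-upper : ∀ n → n < 2 ^ suc ⌊log₂ n ⌋
log₂-upper n = ≰⇒> λ h → 1+n≰n (subst (_≤ ⌊log₂ n ⌋) (⌊log₂[2^n]⌋≡n (suc ⌊log₂ n ⌋)) (⌊log₂⌋-mono-≤ h))

log₂-positive : ∀ {n} → 2 ≤ n → 1 ≤ ⌊log₂ n ⌋
log₂-positive {n} h = subst (_≤ ⌊log₂ n ⌋) (⌊log₂[2^n]⌋≡n 1) (⌊log₂⌋-mono-≤ h)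

-- Since mN = gm + bm and bm < N, removing one N leaves (m - 1)N < gm; this turns a failure
-- probability below 1/m into success above 1 - 1/m.
majority : ∀ m N g b → 1 ≤ m → g + b ≡ N → b * m < N → (m ∸ 1) * N < g * m
majority m N g b m≥1 g+b≡N bm<N = +-cancelʳ-< N _ _ (begin-strict
  (m ∸ 1) * N + N     ≡⟨ +-comm ((m ∸ 1) * N) N ⟩
  (1 + (m ∸ 1)) * N   ≡⟨ cong (λ t → t * N) (m+[n∸m]≡n m≥1) ⟩
  m * N               ≡⟨ *-comm m N ⟩
  N * m               ≡⟨ cong (λ t → t * m) g+b≡N ⟨
  (g + b) * m         ≡⟨ *-distribʳ-+ m g b ⟩
  g * m + b * m       <⟨ +-monoʳ-< (g * m) bm<N ⟩
  g * m + N           ∎)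
  where open ≤-Reasoning

-- With l = ⌊log₂ n⌋ there are l + 1 rounds, and δ = 23 · 8(l + 1) makes a single comparison of two
-- colour classes fail with probability at most 2^(-8(l + 1)).
module _ (n l : ℕ) (l≥1 : 1 ≤ l) (n<2^1+l : n < 2 ^ suc l) (2≤n : 2 ≤ n) where

  private
    R≤2l : suc l ≤ 2 * l
    R≤2l = ≤-trans (+-monoˡ-≤ l l≥1) (≤-reflexive (cong (λ t → l + t) (sym (+-identityʳ l))))

  open Sorter n l (23 * (8 * suc l))
    using (algorithm; play; initial; bad; good+bad; outcome-bound; numComparisons-≤; numRounds-≤; length-ask)

  -- There are l + 1 rounds with budget 18δn each, and l + 1 ≤ 2l; the constant is 13248 = 23 · 8 ·
  -- 18 · 4.
  comparisons-bound : suc l * (n * (23 * (8 * suc l) * 18)) ≤ 13248 * (n * (l * l))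
  comparisons-bound = scaled 23 8 18
    where
    open ≤-Reasoning
    lem₁ : ∀ r n a b d → r * (n * (a * (b * r) * d)) ≡ a * b * d * n * (r * r)
    lem₁ = solve-∀
    lem₂ : ∀ n l a b d → a * b * d * n * (2 * l * (2 * l)) ≡ a * b * d * 4 * (n * (l * l))
    lem₂ = solve-∀
    -- The numerals are kept as variables so that the ring identities are symbolic.
    scaled : ∀ a b d → suc l * (n * (a * (b * suc l) * d)) ≤ a * b * d * 4 * (n * (l * l))
    scaled a b d = begin
      suc l * (n * (a * (b * suc l) * d))        ≡⟨ lem₁ (suc l) n a b d ⟩
      a * b * d * n * (suc l * suc l)            ≤⟨ *-monoʳ-≤ (a * b * d * n) (*-mono-≤ R≤2l R≤2l) ⟩
      a * b * d * n * (2 * l * (2 * l))  ≡⟨ lem₂ n l a b d ⟩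
      a * b * d * 4 * (n * (l * l))      ∎

  rounds-bound : suc l ≤ 13248 * l
  rounds-bound = ≤-trans R≤2l (*-monoˡ-≤ l (≤ᵇ⇒≤ 2 13248 _))

  -- With t = 2^(l + 1), the rounds, the items, the two colours and the target n² contribute at most
  -- t, t, t² and t², and the tests a factor 3. The exponent 8 suffices because 3t⁶ < 4t⁶ ≤ t⁸.
  union-bound-small : suc l * (n * (3 * (2 ^ l * 2 ^ l))) * n ^ 2 < 2 ^ (8 * suc l)
  union-bound-small = begin-strict
    suc l * (n * (3 * (2 ^ l * 2 ^ l))) * n ^ 2
      ≤⟨ *-mono-≤ (*-mono-≤ R≤t (*-mono-≤ n≤t (*-monoʳ-≤ 3 (*-mono-≤ l≤t l≤t)))) (^-monoˡ-≤ 2 n≤t) ⟩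
    t * (t * (3 * (t * t))) * t ^ 2
      ≡⟨ lem t ⟩
    3 * t ^ 6
      <⟨ *-monoˡ-< (t ^ 6) (≤-refl {4}) ⟩
    4 * t ^ 6
      ≤⟨ *-monoˡ-≤ (t ^ 6) (^-monoˡ-≤ 2 2≤t) ⟩
    t ^ 2 * t ^ 6
      ≡⟨ ^-distribˡ-+-* t 2 6 ⟨
    t ^ 8
      ≡⟨ trans (^-*-assoc 2 (suc l) 8) (cong (λ e → 2 ^ e) (*-comm (suc l) 8)) ⟩
    2 ^ (8 * suc l) ∎
    where
    open ≤-Reasoning
    t = 2 ^ suc l
    instance _ = m^n≢0 t 6 {{m^n≢0 2 (suc l)}}
    lem : ∀ t → t * (t * (3 * (t * t))) * (t * (t * 1)) ≡ 3 * (t * (t * (t * (t * (t * (t * 1))))))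
    lem = solve-∀
    R≤t : suc l ≤ t
    R≤t = <⇒≤ (n<2^n (suc l))
      where
      n<2^n : ∀ k → k < 2 ^ k
      n<2^n zero    = s≤s z≤n
      n<2^n (suc k) = ≤-trans (+-mono-≤ (m^n>0 2 k) (n<2^n k)) (≤-reflexive (cong (λ s → 2 ^ k + s) (sym (+-identityʳ _))))
    n≤t : n ≤ t
    n≤t = <⇒≤ n<2^1+l
    l≤t : 2 ^ l ≤ t
    l≤t = ^-monoʳ-≤ 2 (n≤1+n l)
    2≤t : 2 ≤ t
    2≤t = ^-monoʳ-≤ 2 {1} {suc l} (s≤s z≤n)

  module _ (x : Fin n → ℚ) (adv : Adversary n) where

    resources : ∀ ρ →
      numComparisons (finalHistory (algorithm (suc l)) x adv ρ) ≤ 13248 * (n * (l * l))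
      × numRounds (finalHistory (algorithm (suc l)) x adv ρ) ≤ 13248 * l
    resources ρ = ≤-trans (numComparisons-≤ x adv (suc l) ρ length-ask) comparisons-bound ,
                  ≤-trans (numRounds-≤ x adv (suc l) ρ) rounds-bound

    private
      N = 2 ^ (suc l * (n * l))
      P? : ∀ y → Dec (IsApproxSorting ((ℤ.+ 4) ℚ./ 1) x y)
      P? = isApproxSorting? ((ℤ.+ 4) ℚ./ 1) x
      bads : ℕ
      bads = ∑ (allBits (suc l * (n * l))) (λ ρ → bad x adv P? (play x adv (suc l) ρ [] initial))

    bads-bound : bads * n ^ 2 < N
    bads-bound = *-cancelʳ-< (2 ^ (8 * suc l)) _ _ (begin-strict
      bads * n ^ 2 * 2 ^ (8 * suc l)                ≡⟨ lem bads (n ^ 2) (2 ^ (8 * suc l)) ⟩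
      bads * 2 ^ (8 * suc l) * n ^ 2
        ≤⟨ *-monoˡ-≤ (n ^ 2) (outcome-bound x adv (suc l) (8 * suc l) n<2^1+l (<⇒≤ n<2^1+l) refl (s≤s z≤n)) ⟩
      suc l * (n * (3 * (2 ^ l * 2 ^ l))) * N * n ^ 2   ≡⟨ lem (suc l * (n * (3 * (2 ^ l * 2 ^ l)))) N (n ^ 2) ⟩
      suc l * (n * (3 * (2 ^ l * 2 ^ l))) * n ^ 2 * N   <⟨ *-monoˡ-< N union-bound-small ⟩
      2 ^ (8 * suc l) * N                           ≡⟨ *-comm (2 ^ (8 * suc l)) N ⟩
      N * 2 ^ (8 * suc l)                           ∎)
      where
      open ≤-Reasoning
      instance _ = m^n≢0 2 (suc l * (n * l))
      lem : ∀ a b d → a * b * d ≡ a * d * b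
      lem = solve-∀

    success : (n ^ 2 ∸ 1) * 2 ^ Algorithm.rbits (algorithm (suc l))
      < countGood (λ ρ → isApproxSorting? ((ℤ.+ 4) ℚ./ 1) x (result (algorithm (suc l)) x adv ρ)) * n ^ 2
    success = majority (n ^ 2) N _ bads (m^n>0 n 2) (good+bad x adv P? (suc l)) bads-bound
      where instance _ = >-nonZero (≤-trans (s≤s z≤n) 2≤n)

open import Data.Integer using (+_)
open import Data.Rational using (_/_)

theorem1p5 : Σ ((n : ℕ) → Algorithm n) λ alg →
    ∃ λ (C : ℕ) →
    ∀ (n : ℕ) → 2 ≤ n →
    (∀ (x : Fin n → ℚ) (adv : Adversary n) (ρ : Bits (Algorithm.rbits (alg n))) →
    numComparisons (finalHistory (alg n) x adv ρ) ≤ C * (n * (⌊log₂ n ⌋ * ⌊log₂ n ⌋))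
    × numRounds (finalHistory (alg n) x adv ρ) ≤ C * ⌊log₂ n ⌋)
    ×
    (∀ (x : Fin n → ℚ) (adv : Adversary n) →
    (n ^ 2 ∸ 1) * 2 ^ Algorithm.rbits (alg n)
    < countGood (λ ρ → isApproxSorting? ((+ 4) / 1) x (result (alg n) x adv ρ)) * n ^ 2)
theorem1p5 = (λ n → Sorter.algorithm n ⌊log₂ n ⌋ (23 * (8 * suc ⌊log₂ n ⌋)) (suc ⌊log₂ n ⌋)) , 13248 , λ n 2≤n →
  (λ x adv ρ → resources n ⌊log₂ n ⌋ (log₂-positive 2≤n) (log₂-upper n) 2≤n x adv ρ) ,
  success n ⌊log₂ n ⌋ (log₂-positive 2≤n) (log₂-upper n) 2≤n
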